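{- Let $S_0,S_1,S_2$ be positive integers with $\gcd(S_0,S_1,S_2)=1$, let $S:\{0,1,2\}^*\to\mathbb{N}$ be the semigroup homomorphism with $S(i)=S_i$, and let $\mathbf t=T(\mathbf f)$. Define $k_1=o_1=\tfrac12S_0-S_1+\tfrac12S_2$, $k_2=o_2=\tfrac12S_0-\tfrac12S_2$, $k_3=o_3=-\tfrac12S_0+\tfrac12S_2$, $k_4=e_1=S_0-S_1$, $k_5=e_2=-S_1+S_2$, $k_6=e_3=0$, $k=\max\{|k_i|:1\le i\le6\}$, and $l=\left\lceil \frac{2(k+1)}{\min\{S_1,\,k_1+S_1\}}\right\rceil$. Let $F=(F[n])_{n\ge1}$ with $F[n]=k_1+S_1$ if $\mathbf f[n]=0$ and $F[n]=S_1$ if $\mathbf f[n]=1$. For $1\le i\le j$ let $I(F[i,j])$ be the real interval $\left[k+1,\ \sum_{q=i}^{j+1}F[q]-(k+1)\right]$, \[\mathbb S^0(F[i,j])=\Big\{\textstyle\sum_{q=i}^sF[q]+e_r+(o_r-e_r)\big(|\mathbf f[i,s]|_0\bmod 2\big): r\in\{1,2,3\},\ i\le s\le j\Big\},\] \[\mathbb S^1(F[i,j])=\Big\{\textstyle\sum_{q=i}^sF[q]+e_r+(o_r-e_r)\big(1-(|\mathbf f[i,s]|_0\bmod 2)\big): r\in\{1,2,3\},\ i\le s\le j\Big\},\] $\mathbb K^0(F[i,j])=\big(I(F[i,j])\setminus\mathbb S^0(F[i,j])\big)\cap\mathbb N$ and $\mathbb K^1(F[i,j])=\big(((k_1+S_1)+I(F[i,j]))\setminus((k_1+S_1)+\mathbb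 S^1(F[i,j]))\big)\cap\mathbb N$. Then $\mathbb N\setminus S(\mathcal L_{\mathbf t})$ is finite if and only if $\mathbb K^0(F[i,i+l-1])=\mathbb K^1(F[i,i+l-1])=\emptyset$ for all $i\ge1$.
   Context: $\varphi=(1+\sqrt5)/2$, $\alpha=2-\varphi$, $\mathbf{f}=(\lfloor (n+1)\alpha\rfloor-\lfloor n\alpha\rfloor)_{n\ge1}$ is the Fibonacci word, $\mathbf f[n]$ its $n$-th letter and $\mathbf f[i,s]=\mathbf f[i]\cdots\mathbf f[s]$; $|w|_0$ is the number of $0$'s in $w$. $T$ keeps each $1$ and, among the occurrences of $0$ in order, replaces the 2nd, 4th, 6th, $\dots$ by $2$. For $c\in\mathbb R$ and $A\subseteq\mathbb R$, $c+A=\{c+a:a\in A\}$. $\mathcal L_{\mathbf t}$ is the set of factors of $\mathbf t$ and $S(\mathcal L_{\mathbf t})=\{S(u):u\in\mathcal L_{\mathbf t}\}$, where $S(uv)=S(u)+S(v)$. -}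

module Defs where

open import Data.Bool using (Bool; true; false; _∧_; if_then_else_)
open import Data.Nat as ℕ using (ℕ; zero; suc; _≤ᵇ_; _≡ᵇ_; _∸_; _⊔_; _⊓_)
open import Data.Nat.DivMod using (_/_; _%_)
open import Data.Integer as ℤ using (ℤ; +_; ∣_∣)
open import Relation.Binary.PropositionalEquality using (_≡_)

-- Fibonacci word  f[n] = ⌊(n+1)α⌋ - ⌊nα⌋,  α = 2 - φ = (3 - √5)/2

-- For 1 ≤ m, m ≤ n·α  ⇔  n√5 ≤ 3n - 2m  ⇔  2m ≤ 3n ∧ 5n² ≤ (3n - 2m)².
-- This is an exact (integer) test of  m ≤ n·α.
leNα : ℕ → ℕ → Bool
leNα n m = ((2 ℕ.* m) ≤ᵇ (3 ℕ.* n)) ∧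
           ((5 ℕ.* (n ℕ.* n)) ≤ᵇ ((3 ℕ.* n ∸ 2 ℕ.* m) ℕ.* (3 ℕ.* n ∸ 2 ℕ.* m)))

countLe : ℕ → ℕ → ℕ
countLe n zero = zero
countLe n (suc c) = (if leNα n (suc c) then 1 else 0) ℕ.+ countLe n c

-- ⌊n·α⌋ : since 0 ≤ n·α < n, it equals #{m ∈ {1..n} : m ≤ n·α}
floorNα : ℕ → ℕ
floorNα n = countLe n n

-- f[n] (meaningful for n ≥ 1)
fib : ℕ → ℕ
fib n = floorNα (suc n) ∸ floorNα n

-- |f[i,s]|₀ = number of 0's among f[i],…,f[s]  (0 if s < i)
zerosIn : ℕ → ℕ → ℕ
zerosIn i s = go (suc s ∸ i) i
  where
  go : ℕ → ℕ → ℕ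
  go zero p = zero
  go (suc c) p = (if fib p ≡ᵇ 0 then 1 else 0) ℕ.+ go c (suc p)

-- t = T(f): keep each 1; among the 0's, the 2nd, 4th, … become 2

tw : ℕ → ℕ
tw n with fib n ≡ᵇ 0
... | false = 1
... | true with zerosIn 1 n % 2 ≡ᵇ 0
...   | true = 2
...   | false = 0

Sletter : ℕ → ℕ → ℕ → ℕ → ℕ
Sletter S₀ S₁ S₂ 0 = S₀
Sletter S₀ S₁ S₂ 1 = S₁
Sletter S₀ S₁ S₂ _ = S₂

Sfactor : ℕ → ℕ → ℕ → ℕ → ℕ → ℕ
Sfactor S₀ S₁ S₂ i zero = zero
Sfactor S₀ S₁ S₂ i (suc len) = Sletter S₀ S₁ S₂ (tw i) ℕ.+ Sfactor S₀ S₁ S₂ (suc i) len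

-- n ∈ S(ℒ_t): n = S(u) for a factor u = t[i, i+len-1] (i ≥ 1, len ≥ 0;
-- len = 0 is the empty factor)
data InSL (S₀ S₁ S₂ : ℕ) (n : ℕ) : Set where
  factor : (i len : ℕ) → 1 ℕ.≤ i → Sfactor S₀ S₁ S₂ i len ≡ n → InSL S₀ S₁ S₂ n

-- All half-integer quantities of the theorem are stored DOUBLED (in ℤ).

module Doubled (S₀ S₁ S₂ : ℕ) where
  s₀ s₁ s₂ : ℤ
  s₀ = + S₀
  s₁ = + S₁
  s₂ = + S₂

  K₁ K₂ K₃ K₄ K₅ K₆ : ℤ
  K₁ = s₀ ℤ.- + 2 ℤ.* s₁ ℤ.+ s₂
  K₂ = s₀ ℤ.- s₂
  K₃ = s₂ ℤ.- s₀
  K₄ = + 2 ℤ.* (s₀ ℤ.- s₁)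
  K₅ = + 2 ℤ.* (s₂ ℤ.- s₁)
  K₆ = + 0

  -- 2o_r and 2e_r, r ∈ {1,2,3} (encoded as 0,1,2)
  O E : ℕ → ℤ
  O 0 = K₁
  O 1 = K₂
  O _ = K₃
  E 0 = K₄
  E 1 = K₅
  E _ = K₆

  kk : ℕ
  kk = ∣ K₁ ∣ ⊔ ∣ K₂ ∣ ⊔ ∣ K₃ ∣ ⊔ ∣ K₄ ∣ ⊔ ∣ K₅ ∣ ⊔ ∣ K₆ ∣

  -- 2(k₁ + S₁) = S₀ + S₂
  C : ℤ
  C = K₁ ℤ.+ + 2 ℤ.* s₁

  mm : ℕ
  mm = (2 ℕ.* S₁) ⊓ ∣ C ∣

  -- ceiling division (second argument positive)
  ceilDiv : ℕ → ℕ → ℕ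
  ceilDiv a zero = zero
  ceilDiv a (suc b) = (a ℕ.+ b) / suc b

  -- l = ⌈2(k+1) / min{S₁, k₁+S₁}⌉ = ⌈2(2k+2) / (2 min{…})⌉
  l : ℕ
  l = ceilDiv (2 ℕ.* (kk ℕ.+ 2)) mm

  F : ℕ → ℤ
  F n with fib n ≡ᵇ 0
  ... | true = C
  ... | false = + 2 ℤ.* s₁

  -- 2 Σ_{q=i}^{s} F[q]   (0 if s < i)
  sumF : ℕ → ℕ → ℤ
  sumF i s = go (suc s ∸ i) i
    where
    go : ℕ → ℕ → ℤ
    go zero p = + 0
    go (suc c) p = F p ℤ.+ go c (suc p)

  par : ℕ → ℕ → ℤ
  par i s = + (zerosIn i s % 2)

  sig0 sig1 : ℕ → ℕ → ℕ → ℤ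
  sig0 i s r = sumF i s ℤ.+ E r ℤ.+ (O r ℤ.- E r) ℤ.* par i s
  sig1 i s r = sumF i s ℤ.+ E r ℤ.+ (O r ℤ.- E r) ℤ.* (+ 1 ℤ.- par i s)

{-# OPTIONS --safe #-}
-- By balancedness of 𝐟, a factor of length s + 1 has as many zeros as 𝐟[1,s] or one more, and 𝐟
-- returns to its beginning after either letter and with either parity of the number of preceding
-- zeros.  Hence the values of S on nonempty factors of 𝐭 are exactly S₁ + ΣF[1,s] + (o_r or e_r),
-- s ≥ 0, with o_r or e_r chosen by the parity of |𝐟[1,s]|₀.  The margin k + 1 keeps the values with s
-- outside a window out of its interval I, so an integer missed in one window is missed again at
-- every return of that window with the same parity; conversely, by the choice of l, consecutive
-- intervals I overlap.
--
-- The returns happen at Fibonacci numbers.  One step of the Euclidean algorithm turns the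
-- comparison of φ p with z into the reverse comparison of φ (z - p) with p and maps
-- (Fib (k + 1), Fib (k + 2)) to (Fib k, Fib (k + 1)), so adding a pair of consecutive Fibonacci
-- numbers to a small nonzero (p, z) does not change the comparison.
module Submission where

open import Defs
open import Data.Nat
open import Data.Nat.Properties
open import Data.Nat.DivMod
open import Data.Nat.GCD using (gcd)
open import Data.Nat.Induction using (<-rec)
open import Data.Nat.Tactic.RingSolver using (solve-∀)
open import Data.Integer as ℤ using (ℤ; +_; -[1+_]; ∣_∣)
import Data.Integer.Properties as ℤ
import Data.Integer.Tactic.RingSolver as ℤ-Solver
open import Algebra.Properties.AbelianGroup ℤ.+-0-abelianGroup using (∙-cancelʳ; ∙-cancelˡ)
open import Data.Bool using (Bool; true; false; T; if_then_else_; _xor_)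
open import Data.Bool.Properties using (T-∧; T-≡)
open import Data.Product
open import Data.Sum using (_⊎_; inj₁; inj₂; [_,_]′)
open import Data.Empty using (⊥-elim; ⊥)
open import Function using (_∘_; _$_; _⇔_; mk⇔; Equivalence)
open import Relation.Nullary
open import Relation.Nullary.Decidable using (map′; _×-dec_; decidable-stable)
open import Relation.Binary.PropositionalEquality

-- Comparison with multiples of the golden ratio

infix 4 _φ≤_

-- p φ≤ z encodes φ p ≤ z.
record _φ≤_ (p z : ℕ) : Set where
  constructor mkφ≤
  field quadratic : p * p + p * z ≤ z * z

open _φ≤_

_φ≤?_ : ∀ p z → Dec (p φ≤ z)
p φ≤? z = map′ mkφ≤ quadratic ((p * p + p * z) ≤? (z * z))

φ≤⇒≤ : ∀ {p z} → p φ≤ z → p ≤ z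
φ≤⇒≤ {p} {z} h = ≮⇒≥ λ z<p → <-irrefl refl
  (<-≤-trans (*-mono-< z<p z<p) (≤-trans (m≤m+n (p * p) (p * z)) (quadratic h)))

-- The inequality is homogeneous of degree two, so it depends only on the ratio `p / z`: after
-- multiplication by `z * z`, the hypothesis `r` replaces each `p′ * z` by `p * z′`.
φ≤-ratio : ∀ {p z p′ z′} → 0 < z → p φ≤ z → p′ * z ≤ p * z′ → p′ φ≤ z′
φ≤-ratio {p} {z@(suc _)} {p′} {z′} _ h r = mkφ≤ $ *-cancelʳ-≤ _ _ (z * z) (begin
  (p′ * p′ + p′ * z′) * (z * z)                    ≡⟨ e₁ p′ z′ z ⟩
  (p′ * z) * (p′ * z) + (p′ * z) * (z′ * z)        ≤⟨ +-mono-≤ (*-mono-≤ r r) (*-monoˡ-≤ (z′ * z) r) ⟩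
  (p * z′) * (p * z′) + (p * z′) * (z′ * z)        ≡⟨ e₂ p z z′ ⟩
  (z′ * z′) * (p * p + p * z)                      ≤⟨ *-monoʳ-≤ (z′ * z′) (quadratic h) ⟩
  (z′ * z′) * (z * z)                              ∎)
  where
  open ≤-Reasoning
  e₁ : ∀ a b c → (a * a + a * b) * (c * c) ≡ (a * c) * (a * c) + (a * c) * (b * c)
  e₁ = solve-∀
  e₂ : ∀ a c b → (a * b) * (a * b) + (a * b) * (b * c) ≡ (b * b) * (a * a + a * c)
  e₂ = solve-∀

φ≤-mono : ∀ {p z p′ z′} → p′ ≤ p → z ≤ z′ → p φ≤ z → p′ φ≤ z′
φ≤-mono {z = zero} p′≤p _ h with n≤0⇒n≡0 (≤-trans p′≤p (φ≤⇒≤ h))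
... | refl = mkφ≤ z≤n
φ≤-mono {p} {suc z} p′≤p z≤z′ h = φ≤-ratio z<s h (*-mono-≤ p′≤p z≤z′)

-- The mediant of two ratios is at most the larger one. Zero denominators, where `φ≤-ratio` does not
-- apply, are treated separately.
φ≤-+ : ∀ {p z p′ z′} → p φ≤ z → p′ φ≤ z′ → p + p′ φ≤ z + z′
φ≤-+ {p} {zero} {p′} {z′} h h′ with n≤0⇒n≡0 (φ≤⇒≤ h)
... | refl = h′
φ≤-+ {p} {z@(suc _)} {p′} {zero} h h′ with n≤0⇒n≡0 (φ≤⇒≤ h′)
... | refl = φ≤-mono (≤-reflexive (+-identityʳ p)) (≤-reflexive (sym (+-identityʳ z))) h
φ≤-+ {p} {z@(suc _)} {p′} {z′@(suc _)} h h′ with ≤-total (p * z′) (p′ * z)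
... | inj₁ r = φ≤-ratio z<s h′ (begin
  (p + p′) * z′      ≡⟨ *-distribʳ-+ z′ p p′ ⟩
  p * z′ + p′ * z′   ≤⟨ +-monoˡ-≤ (p′ * z′) r ⟩
  p′ * z + p′ * z′   ≡⟨ *-distribˡ-+ p′ z z′ ⟨
  p′ * (z + z′)      ∎)
  where open ≤-Reasoning
... | inj₂ r = φ≤-ratio z<s h (begin
  (p + p′) * z       ≡⟨ *-distribʳ-+ z p p′ ⟩
  p * z + p′ * z     ≤⟨ +-monoʳ-≤ (p * z) r ⟩
  p * z + p * z′     ≡⟨ *-distribˡ-+ p z z′ ⟨
  p * (z + z′)       ∎)
  where open ≤-Reasoning

-- Dually, the smaller of the two ratios is at most their mediant.
φ≤-split : ∀ {p z p′ z′} → p + p′ φ≤ z + z′ → p φ≤ z ⊎ p′ φ≤ z′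
φ≤-split {p} {zero} {p′} {zero} h with p | φ≤⇒≤ h
... | zero | _ = inj₁ (mkφ≤ z≤n)
φ≤-split {p} {z} {p′} {z′} h with (z + z′) in eq
... | zero with m+n≡0⇒m≡0 z eq | m+n≡0⇒n≡0 z eq | n≤0⇒n≡0 (φ≤⇒≤ h)
...   | refl | refl | e with m+n≡0⇒m≡0 p e
...     | refl = inj₁ (mkφ≤ z≤n)
φ≤-split {p} {z} {p′} {z′} h | s@(suc _) with ≤-total (p * z′) (p′ * z)
... | inj₁ r = inj₁ (φ≤-ratio z<s h (begin
  p * s              ≡⟨ cong (p *_) eq ⟨
  p * (z + z′)       ≡⟨ *-distribˡ-+ p z z′ ⟩
  p * z + p * z′     ≤⟨ +-monoʳ-≤ (p * z) r ⟩
  p * z + p′ * z     ≡⟨ *-distribʳ-+ z p p′ ⟨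
  (p + p′) * z       ∎))
  where open ≤-Reasoning
... | inj₂ r = inj₂ (φ≤-ratio z<s h (begin
  p′ * s              ≡⟨ cong (p′ *_) eq ⟨
  p′ * (z + z′)       ≡⟨ *-distribˡ-+ p′ z z′ ⟩
  p′ * z + p′ * z′    ≤⟨ +-monoˡ-≤ (p′ * z′) r ⟩
  p * z′ + p′ * z′    ≡⟨ *-distribʳ-+ z′ p p′ ⟨
  (p + p′) * z′       ∎))
  where open ≤-Reasoning

-- Infinite descent: the equation says `p = φ y`, and `p = y + x` turns a solution `(y, p)` into the
-- smaller solution `(x, y)`.
φ-irrational : ∀ p y → y * y + y * p ≡ p * p → p ≡ 0
φ-irrational = <-rec _ λ p rec y eq → go p rec y eq
  where
  e : ∀ y x → y * y + y * (y + x) ≡ y * y + (y * y + x * y)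
  e = solve-∀
  e′ : ∀ y x → (y + x) * (y + x) ≡ y * y + (x * x + x * y + x * y)
  e′ = solve-∀
  go : ∀ p → (∀ {p′} → p′ < p → ∀ y → y * y + y * p′ ≡ p′ * p′ → p′ ≡ 0) →
       ∀ y → y * y + y * p ≡ p * p → p ≡ 0
  go p rec y eq with m≤n⇒∃[o]m+o≡n (φ≤⇒≤ {y} {p} (mkφ≤ (≤-reflexive eq)))
  go p rec zero eq | _ , refl = [ (λ h → h) , (λ h → h) ]′ (m*n≡0⇒m≡0∨n≡0 p (sym eq))
  go p rec y@(suc _) eq | x , refl with x*x+xy≡yy
    where
    x*x+xy≡yy : x * x + x * y ≡ y * y
    x*x+xy≡yy = sym (+-cancelʳ-≡ (x * y) _ _ (+-cancelˡ-≡ (y * y) _ _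
      (trans (sym (e y x)) (trans eq (e′ y x)))))
  go p rec y@(suc _) eq | zero , refl | ()
  go p rec y@(suc _) eq | suc x , refl | eq′ with rec (m<m+n y z<s) (suc x) eq′
  ... | ()

-- Since `φ - 1 = 1 / φ`, the bound `φ p ≤ p + y` amounts to `p ≤ φ y`; together with `φ y ≤ p` it
-- would give an equality, which irrationality excludes unless `p + y = 0`.
φ≤-euclid⁺ : ∀ {p y} → 0 < p + y → p φ≤ p + y → ¬ y φ≤ p
φ≤-euclid⁺ {p} {y} pos h h′ = <-irrefl refl (subst (0 <_) both0 pos)
  where
  e₁ : ∀ p y → p * p + p * (p + y) ≡ p * p + p * y + p * p
  e₁ = solve-∀
  e₂ : ∀ p y → (p + y) * (p + y) ≡ p * p + p * y + (y * y + y * p)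
  e₂ = solve-∀
  p≡0 : p ≡ 0
  p≡0 = φ-irrational p y (≤-antisym (quadratic h′) (+-cancelˡ-≤ (p * p + p * y) _ _
    (subst₂ _≤_ (e₁ p y) (e₂ p y) (quadratic h))))
  both0 : p + y ≡ 0
  both0 = cong₂ _+_ p≡0 (n≤0⇒n≡0 (subst (y ≤_) p≡0 (φ≤⇒≤ h′)))

φ≤-euclid⁻ : ∀ {p y} → ¬ y φ≤ p → p φ≤ p + y
φ≤-euclid⁻ {p} {y} h = mkφ≤ $ subst₂ _≤_ (sym (e₁ p y)) (sym (e₂ p y))
  (+-monoʳ-≤ (p * p + p * y) (<⇒≤ (≰⇒> (h ∘ mkφ≤))))
  where
  e₁ : ∀ p y → p * p + p * (p + y) ≡ p * p + p * y + p * p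
  e₁ = solve-∀
  e₂ : ∀ p y → (p + y) * (p + y) ≡ p * p + p * y + (y * y + y * p)
  e₂ = solve-∀

-- The floors ⌊nα⌋

-- Fibonacci numbers (fib is the Fibonacci word).
Fib : ℕ → ℕ
Fib 0 = 0
Fib 1 = 1
Fib (suc (suc k)) = Fib (suc k) + Fib k

Fib-pos : ∀ k → 0 < Fib (suc k)
Fib-pos zero = z<s
Fib-pos (suc k) = ≤-trans (Fib-pos k) (m≤m+n _ _)

k<Fib[2+k] : ∀ k → k < Fib (2 + k)
k<Fib[2+k] zero = z<s
k<Fib[2+k] (suc k) = begin-strict
  suc k                   ≡⟨ +-comm 1 k ⟩
  k + 1                   <⟨ +-mono-<-≤ (k<Fib[2+k] k) (Fib-pos k) ⟩
  Fib (2 + k) + Fib (1 + k) ∎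
  where open ≤-Reasoning

¬φ≤0 : ∀ {p} → ¬ (suc p φ≤ 0)
¬φ≤0 h with φ≤⇒≤ h
... | ()

0φ≤ : ∀ z → 0 φ≤ z
0φ≤ z = mkφ≤ z≤n

-- One step of the Euclidean algorithm swaps the two bounds.
mutual
  Fib-φ≤ : ∀ k → Fib k φ≤ suc (Fib (suc k))
  Fib-φ≤ zero = 0φ≤ _
  Fib-φ≤ (suc k) = subst (Fib (suc k) φ≤_) (+-suc _ _) (φ≤-euclid⁻ (Fib-¬φ≤ k))

  Fib-¬φ≤ : ∀ k → ¬ (suc (Fib k) φ≤ Fib (suc k))
  Fib-¬φ≤ zero h with quadratic h
  ... | s≤s ()
  Fib-¬φ≤ (suc k) h with m≤n⇒∃[o]m+o≡n (φ≤⇒≤ h)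
  ... | y , eq = φ≤-euclid⁺ z<s (subst (suc (Fib (suc k)) φ≤_) (sym eq) h)
    (φ≤-mono y≤ ≤-refl (Fib-φ≤ k))
    where
    y≤ : y ≤ Fib k
    y≤ = <⇒≤ (≤-reflexive (+-cancelˡ-≡ (Fib (suc k)) _ _ (trans (+-suc _ y) eq)))

-- Induction along the Euclidean algorithm. For `0 < p ≤ z` one step passes from `(p, z)` and
-- `suc k` to `(z - p, p)` and `k`, reversing both comparisons; `p + z ≤ k` provides enough steps to
-- reach a terminal case. With `p = 0` both sides hold, with `p > z` both fail.
Fib-shift : ∀ k p z → 0 < p + z → p + z ≤ k → (Fib k + p φ≤ Fib (suc k) + z) ⇔ (p φ≤ z)
Fib-shift zero zero zero () _
Fib-shift k zero (suc z) _ _ = mk⇔ (λ _ → 0φ≤ _) λ _ →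
  φ≤-mono (≤-reflexive (+-identityʳ _)) (≤-trans (s≤s (m≤m+n _ z)) (≤-reflexive (sym (+-suc _ z)))) (Fib-φ≤ k)
Fib-shift (suc k) (suc p) z _ (s≤s p+z≤k) with suc p ≤? z
... | yes 1+p≤z with m≤n⇒∃[o]m+o≡n 1+p≤z
...   | y , refl = mk⇔
  (λ h → φ≤-euclid⁻ λ h′ → φ≤-euclid⁺ pos (subst (Fib (suc k) + suc p φ≤_) e h) (Equivalence.from ih h′))
  (λ h → subst (Fib (suc k) + suc p φ≤_) (sym e) (φ≤-euclid⁻ λ h′ → φ≤-euclid⁺ z<s h (Equivalence.to ih h′)))
  where
  ih : (Fib k + y φ≤ Fib (suc k) + suc p) ⇔ (y φ≤ suc p)
  ih = Fib-shift k y (suc p) (≤-trans z<s (m≤n+m (suc p) y))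
    (≤-trans (≤-trans (≤-reflexive (+-comm y (suc p))) (m≤n+m (suc p + y) p)) p+z≤k)
  pos : 0 < Fib (suc k) + suc p + (Fib k + y)
  pos = ≤-trans (Fib-pos k) (≤-trans (m≤m+n _ (suc p)) (m≤m+n _ _))
  e : Fib (2 + k) + (suc p + y) ≡ Fib (suc k) + suc p + (Fib k + y)
  e = lem (Fib (suc k)) (Fib k) (suc p) y
    where
    lem : ∀ a b c d → a + b + (c + d) ≡ a + c + (b + d)
    lem = solve-∀
Fib-shift (suc k) (suc p) z _ _ | no ¬1+p≤z = mk⇔
  (λ h → ⊥-elim (unshiftable z
    (φ≤-mono (≤-trans (s≤s (+-monoʳ-≤ (Fib (suc k)) (≤-pred (≰⇒> ¬1+p≤z)))) (≤-reflexive (sym (+-suc _ p)))) ≤-refl h)))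
  (λ h → ⊥-elim (¬1+p≤z (φ≤⇒≤ h)))
  where
  -- A common summand `z` cannot rescue the bound refuted by `Fib-¬φ≤`: the alternative `z φ≤ z`
  -- given by `φ≤-split` forces `z = 0`.
  unshiftable : ∀ z → ¬ (suc (Fib (suc k)) + z φ≤ Fib (2 + k) + z)
  unshiftable z h with φ≤-split {suc (Fib (suc k))} {Fib (2 + k)} {z} {z} h
  ... | inj₁ h′ = Fib-¬φ≤ (suc k) h′
  unshiftable zero h | inj₂ _ = Fib-¬φ≤ (suc k) (subst₂ _φ≤_ (+-identityʳ _) (+-identityʳ _) h)
  unshiftable (suc z) h | inj₂ h′ =
    φ≤-euclid⁺ z<s (subst (suc z φ≤_) (sym (+-identityʳ (suc z))) h′) (0φ≤ _)

-- Since `1 / α = φ + 1`, `m ≤ n α` means `φ m ≤ n - m`; so `g = ⌊n α⌋` and `z = n - g`. At `z = 0`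
-- the truncation in `pred` does no harm, because `suc g φ≤ 0` is false.
record Floor (n g z : ℕ) : Set where
  constructor mkFloor
  field
    total : n ≡ g + z
    lower : g φ≤ z
    upper : ¬ (suc g φ≤ pred z)

leNα-correct : ∀ m z → T (leNα (m + z) m) ⇔ m φ≤ z
leNα-correct m z = mk⇔
  (λ t → mkφ≤ (*-cancelˡ-≤ 4 (+-cancelˡ-≤ base _ _
    (subst₂ _≤_ (e₁ m z) square (≤ᵇ⇒≤ _ _ (proj₂ (Equivalence.to T-∧ t)))))))
  (λ h → Equivalence.from T-∧
    ( ≤⇒≤ᵇ (≤-trans (m≤m+n (2 * m) (m + 3 * z)) (≤-reflexive (sym (e₃ m z))))
    , ≤⇒≤ᵇ (subst₂ _≤_ (sym (e₁ m z)) (sym square) (+-monoʳ-≤ base (*-monoʳ-≤ 4 (quadratic h))))))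
  where
  base : ℕ
  base = m * m + 6 * (m * z) + 5 * (z * z)
  e₁ : ∀ m z → 5 * ((m + z) * (m + z)) ≡ (m * m + 6 * (m * z) + 5 * (z * z)) + 4 * (m * m + m * z)
  e₁ = solve-∀
  e₂ : ∀ m z → (m + 3 * z) * (m + 3 * z) ≡ (m * m + 6 * (m * z) + 5 * (z * z)) + 4 * (z * z)
  e₂ = solve-∀
  e₃ : ∀ m z → 3 * (m + z) ≡ 2 * m + (m + 3 * z)
  e₃ = solve-∀
  diff : 3 * (m + z) ∸ 2 * m ≡ m + 3 * z
  diff = trans (cong (_∸ 2 * m) (e₃ m z)) (m+n∸m≡n (2 * m) (m + 3 * z))
  square : (3 * (m + z) ∸ 2 * m) * (3 * (m + z) ∸ 2 * m) ≡ base + 4 * (z * z)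
  square = trans (cong (λ d → d * d) diff) (e₂ m z)

module _ {n g z : ℕ} (fl : Floor n g z) where
  open Floor fl

  leNα-below : ∀ m → m ≤ g → leNα n m ≡ true
  leNα-below m m≤g with m≤n⇒∃[o]m+o≡n m≤g
  ... | o , refl = subst (λ x → leNα x m ≡ true) (trans (sym (+-assoc m o z)) (sym total))
    (Equivalence.to T-≡ (Equivalence.from (leNα-correct m (o + z))
      (φ≤-mono m≤g (m≤n+m z o) lower)))

  leNα-above : ∀ o → suc (g + o) ≤ n → leNα n (suc (g + o)) ≡ false
  leNα-above o le with leNα n (suc (g + o)) in eq
  ... | false = refl
  ... | true with m≤n⇒∃[o]m+o≡n le
  ...   | y , eq′ = ⊥-elim (upper (φ≤-mono (s≤s (m≤m+n g o)) y≤
      (Equivalence.to (leNα-correct (suc (g + o)) y)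
        (Equivalence.from T-≡ (subst (λ x → leNα x (suc (g + o)) ≡ true) (sym eq′) eq)))))
    where
    y≤ : y ≤ pred z
    y≤ = pred-mono-≤ (+-cancelˡ-≤ g _ _ (begin
      g + suc y        ≡⟨ +-suc g y ⟩
      suc (g + y)      ≤⟨ s≤s (+-monoˡ-≤ y (m≤m+n g o)) ⟩
      suc (g + o + y)  ≡⟨ trans eq′ total ⟩
      g + z            ∎))
      where open ≤-Reasoning

  countLe-below : ∀ c → c ≤ g → countLe n c ≡ c
  countLe-below zero _ = refl
  countLe-below (suc c) c<g rewrite leNα-below (suc c) c<g = cong suc (countLe-below c (<⇒≤ c<g))

  countLe-above : ∀ o → g + o ≤ n → countLe n (g + o) ≡ g
  countLe-above zero _ = trans (cong (countLe n) (+-identityʳ g)) (countLe-below g ≤-refl)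
  countLe-above (suc o) le rewrite +-suc g o | leNα-above o le = countLe-above o (<⇒≤ le)

  floor-unique : floorNα n ≡ g
  floor-unique = trans (cong (countLe n) total) (countLe-above z (≤-reflexive (sym total)))

floor-exists : ∀ n → ∃₂ λ g z → Floor n g z
floor-exists zero = 0 , 0 , mkFloor refl (0φ≤ 0) ¬φ≤0
floor-exists (suc n) with floor-exists n
... | g , z , mkFloor e lo up with suc g φ≤? z
...   | yes h = suc g , z , mkFloor (cong suc e) h (up ∘ φ≤-mono (n≤1+n _) ≤-refl)
...   | no h = g , suc z , mkFloor (trans (cong suc e) (sym (+-suc g z))) (φ≤-mono ≤-refl (n≤1+n z) lo) h

floor-spec : ∀ n → ∃ λ z → Floor n (floorNα n) z
floor-spec n with floor-exists n
... | g , z , fl = z , subst (λ x → Floor n x z) (sym (floor-unique fl)) fl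

-- The lower bounds add up by `φ≤-+`, and a carry of two would contradict one of the upper bounds by
-- `φ≤-split`.
floor-+ : ∀ m n → floorNα (m + n) ≡ floorNα m + floorNα n ⊎ floorNα (m + n) ≡ suc (floorNα m + floorNα n)
floor-+ m n with floor-spec m | floor-spec n
... | z , mkFloor e lo up | z′ , mkFloor e′ lo′ up′ with suc (floorNα m + floorNα n) φ≤? pred (z + z′)
...   | no h = inj₁ (floor-unique (mkFloor (trans (cong₂ _+_ e e′) (lem (floorNα m) z (floorNα n) z′)) (φ≤-+ lo lo′) h))
  where
  lem : ∀ a b c d → (a + b) + (c + d) ≡ (a + c) + (b + d)
  lem = solve-∀
...   | yes h = inj₂ (floor-unique (mkFloor eq h up″))
  where
  g g′ : ℕ
  g = floorNα m
  g′ = floorNα n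
  lem : ∀ a b c d → (a + b) + (c + d) ≡ (a + c) + (b + d)
  lem = solve-∀
  z+z′≢0 : ∀ w → suc (g + g′) φ≤ pred w → suc (pred w) ≡ w
  z+z′≢0 zero h = ⊥-elim (¬φ≤0 h)
  z+z′≢0 (suc w) h = refl
  eq : m + n ≡ suc (g + g′) + pred (z + z′)
  eq = trans (cong₂ _+_ e e′) (trans (lem g z g′ z′)
    (trans (cong (λ x → g + g′ + x) (sym (z+z′≢0 (z + z′) h))) (+-suc _ _)))
  pred-+ : ∀ a b → pred (pred (a + b)) ≤ pred a + pred b
  pred-+ zero b = pred[n]≤n
  pred-+ (suc a) zero = pred[n]≤n
  pred-+ (suc a) (suc b) = ≤-reflexive (cong pred (+-suc a b))
  up″ : ¬ (suc (suc (g + g′)) φ≤ pred (pred (z + z′)))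
  up″ h′ with φ≤-split {suc g} {pred z} {suc g′} {pred z′}
    (φ≤-mono (≤-reflexive (cong suc (+-suc g g′))) (pred-+ z z′) h′)
  ... | inj₁ h″ = up h″
  ... | inj₂ h″ = up′ h″

-- `Fib-shift` applies to both bounds of the floor, as `Fib (2 + k)` splits into `Fib k` and
-- `Fib (1 + k)`. At `j = 0` the floor depends on the parity of `k`; see `floor-Fib-even` and
-- `suc-floor-Fib-odd`.
floor-shift : ∀ k j → 0 < j → j ≤ k → floorNα (Fib (2 + k) + j) ≡ Fib k + floorNα j
floor-shift k j 0<j j≤k with floor-spec j
... | zero , mkFloor e lo up with n≤0⇒n≡0 (φ≤⇒≤ lo)
...   | g≡0 = ⊥-elim (<-irrefl refl (subst (0 <_) (trans e (cong (_+ 0) g≡0)) 0<j))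
floor-shift k j 0<j j≤k | suc z , mkFloor e lo up = floor-unique (mkFloor
  (trans (cong (λ y → Fib (2 + k) + y) e) (lem (Fib (suc k)) (Fib k) (floorNα j) (suc z)))
  (Equivalence.from (Fib-shift k (floorNα j) (suc z) (subst (0 <_) e 0<j) (subst (_≤ k) e j≤k)) lo)
  (λ h → up (Equivalence.to (Fib-shift k (suc (floorNα j)) z z<s (subst (_≤ k) (trans e (+-suc _ z)) j≤k))
    (subst₂ _φ≤_ (sym (+-suc _ _)) (cong pred (+-suc (Fib (suc k)) z)) h))))
  where
  lem : ∀ a b c d → (a + b) + (c + d) ≡ (b + c) + (a + d)
  lem = solve-∀

-- The sign of `φ Fib k - Fib (k + 1)` alternates with `k`, each Euclidean step reversing it.
Fib-φ≤-even : ∀ j → Fib (j * 2) φ≤ Fib (suc (j * 2))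
Fib-φ≤-odd : ∀ j → ¬ (Fib (suc (j * 2)) φ≤ Fib (2 + (j * 2)))
Fib-φ≤-even zero = 0φ≤ 1
Fib-φ≤-even (suc j) = φ≤-euclid⁻ (Fib-φ≤-odd j)
Fib-φ≤-odd j h = φ≤-euclid⁺ (≤-trans (Fib-pos (j * 2)) (m≤m+n _ _)) h (Fib-φ≤-even j)

floor-Fib-even : ∀ j → floorNα (Fib (2 + j * 2)) ≡ Fib (j * 2)
floor-Fib-even j = floor-unique (mkFloor (+-comm (Fib (suc (j * 2))) _) (Fib-φ≤-even j)
  (Fib-¬φ≤ (j * 2) ∘ φ≤-mono ≤-refl pred[n]≤n))

suc-floor-Fib-odd : ∀ j → suc (floorNα (Fib (3 + j * 2))) ≡ Fib (1 + j * 2)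
suc-floor-Fib-odd j = trans (cong suc (floor-unique {g = pred (Fib k)} (mkFloor eq lo up))) (suc-pred (Fib k))
  where
  k = 1 + j * 2
  instance
    nz : NonZero (Fib k)
    nz = >-nonZero (Fib-pos (j * 2))
  eq : Fib (2 + k) ≡ pred (Fib k) + suc (Fib (1 + k))
  eq = trans (+-comm (Fib (1 + k)) (Fib k)) (trans (cong (_+ Fib (1 + k)) (sym (suc-pred (Fib k)))) (sym (+-suc _ _)))
  lo : pred (Fib k) φ≤ suc (Fib (1 + k))
  lo = φ≤-mono pred[n]≤n ≤-refl (Fib-φ≤ k)
  up : ¬ (suc (pred (Fib k)) φ≤ Fib (1 + k))
  up h = Fib-φ≤-odd j (subst (_φ≤ Fib (1 + k)) (suc-pred (Fib k)) h)

-- Occurrences in the Fibonacci word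

Σ[_] : (ℕ → ℕ) → ℕ → ℕ → ℕ
Σ[ g ] p zero = 0
Σ[ g ] p (suc c) = g p + Σ[ g ] (suc p) c

module _ (g : ℕ → ℕ) where

  Σ-+ : ∀ p m n → Σ[ g ] p (m + n) ≡ Σ[ g ] p m + Σ[ g ] (m + p) n
  Σ-+ p zero n = refl
  Σ-+ p (suc m) n = trans (cong (λ y → g p + y) (trans (Σ-+ (suc p) m n)
    (cong (λ x → Σ[ g ] (suc p) m + Σ[ g ] x n) (+-suc m p)))) (sym (+-assoc (g p) _ _))

  Σ-1-+ : ∀ m n → Σ[ g ] 1 (m + n) ≡ Σ[ g ] 1 m + Σ[ g ] (suc m) n
  Σ-1-+ m n = trans (Σ-+ 1 m n) (cong (λ x → Σ[ g ] 1 m + Σ[ g ] x n) (+-comm m 1))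

  Σ-snoc : ∀ m → Σ[ g ] 1 (suc m) ≡ Σ[ g ] 1 m + g (suc m)
  Σ-snoc m = trans (cong (Σ[ g ] 1) (+-comm 1 m)) (trans (Σ-1-+ m 1) (cong (λ y → Σ[ g ] 1 m + y) (+-identityʳ _)))

  Σ-mono : ∀ p {m n} → m ≤ n → Σ[ g ] p m ≤ Σ[ g ] p n
  Σ-mono p {m} m≤n with m≤n⇒∃[o]m+o≡n m≤n
  ... | o , refl = ≤-trans (m≤m+n _ _) (≤-reflexive (sym (Σ-+ p m o)))

  Σ-lower : ∀ {b} → (∀ p → b ≤ g p) → ∀ p c → c * b ≤ Σ[ g ] p c
  Σ-lower b≤ p zero = z≤n
  Σ-lower b≤ p (suc c) = +-mono-≤ (b≤ p) (Σ-lower b≤ (suc p) c)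

Σ-cong : ∀ {g h : ℕ → ℕ} {p q} c → (∀ o → o < c → g (p + o) ≡ h (q + o)) → Σ[ g ] p c ≡ Σ[ h ] q c
Σ-cong zero _ = refl
Σ-cong {g} {h} {p} {q} (suc c) eq = cong₂ _+_
  (subst₂ (λ x y → g x ≡ h y) (+-identityʳ p) (+-identityʳ q) (eq 0 z<s))
  (Σ-cong c λ o o<c → subst₂ (λ x y → g x ≡ h y) (+-suc p o) (+-suc q o) (eq (suc o) (s<s o<c)))

isZero : ℕ → ℕ
isZero p = if fib p ≡ᵇ 0 then 1 else 0

zeros : ℕ → ℕ → ℕ
zeros = Σ[ isZero ]

mutual
  zerosIn≡zeros : ∀ i s → zerosIn i s ≡ zeros i (suc s ∸ i)
  zerosIn≡zeros i s with suc s ∸ i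
  ... | zero = refl
  -- Generalising `suc i` to a variable lets unification solve the hole in `go≡`; `isZero i`, whose
  -- unfolding contains `suc i`, is set aside first.
  ... | suc c with isZero i
  ...   | a with suc i
  ...     | p = cong (λ y → a + y) (go≡ i s c p)

  -- The hole is solved by the local function of zerosIn, which has no name outside its clause.
  go≡ : ∀ i s c p → _ ≡ zeros p c
  go≡ i s zero p = refl
  go≡ i s (suc c) p = cong (λ y → isZero p + y) (go≡ i s c (suc p))

isZero-floor : ∀ p → isZero p + floorNα (suc p) ≡ suc (floorNα p)
isZero-floor p with floor-+ 1 p
... | inj₁ e rewrite e | n∸n≡0 (floorNα p) = refl
... | inj₂ e rewrite e | m+n∸n≡m 1 (floorNα p) = refl

zeros-floor : ∀ p c → zeros p c + floorNα (c + p) ≡ c + floorNα p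
zeros-floor p zero = refl
zeros-floor p (suc c) = begin
  isZero p + zeros (suc p) c + floorNα (suc c + p)    ≡⟨ +-assoc (isZero p) _ _ ⟩
  isZero p + (zeros (suc p) c + floorNα (suc (c + p))) ≡⟨ cong (λ x → isZero p + (zeros (suc p) c + floorNα x)) (+-suc c p) ⟨
  isZero p + (zeros (suc p) c + floorNα (c + suc p))  ≡⟨ cong (λ y → isZero p + y) (zeros-floor (suc p) c) ⟩
  isZero p + (c + floorNα (suc p))                    ≡⟨ lem (isZero p) c (floorNα (suc p)) ⟩
  c + (isZero p + floorNα (suc p))                    ≡⟨ cong (λ y → c + y) (isZero-floor p) ⟩
  c + suc (floorNα p)                                 ≡⟨ +-suc c _ ⟩
  suc c + floorNα p                                   ∎
  where
  open ≡-Reasoning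
  lem : ∀ a b c → a + (b + c) ≡ b + (a + c)
  lem = solve-∀

zeros-1-floor : ∀ n → zeros 1 n + floorNα (suc n) ≡ n
zeros-1-floor n = trans (cong (λ x → zeros 1 n + floorNα x) (+-comm 1 n)) (trans (zeros-floor 1 n) (+-identityʳ n))

bit : Bool → ℕ
bit false = 0
bit true = 1

-- By `zeros-floor`, the extra zero is present exactly when the sum in `floor-+` has no carry.
balanced : ∀ i n → ∃ λ ε → zeros i (suc n) ≡ bit ε + zeros 1 n
balanced i n = [ (λ e → true , by e) , (λ e → false , by′ e) ]′ (floor-+ (suc n) i)
  where
  G = floorNα
  by : G (suc n + i) ≡ G (suc n) + G i → zeros i (suc n) ≡ 1 + zeros 1 n
  by e = +-cancelʳ-≡ (G (suc n) + G i) _ _ (begin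
    zeros i (suc n) + (G (suc n) + G i)  ≡⟨ cong (λ y → zeros i (suc n) + y) e ⟨
    zeros i (suc n) + G (suc n + i)      ≡⟨ zeros-floor i (suc n) ⟩
    suc n + G i                          ≡⟨ cong (λ x → suc x + G i) (zeros-1-floor n) ⟨
    suc (zeros 1 n + G (suc n)) + G i    ≡⟨ cong suc (+-assoc (zeros 1 n) _ _) ⟩
    1 + zeros 1 n + (G (suc n) + G i)    ∎)
    where open ≡-Reasoning
  by′ : G (suc n + i) ≡ suc (G (suc n) + G i) → zeros i (suc n) ≡ zeros 1 n
  by′ e = +-cancelʳ-≡ (suc (G (suc n) + G i)) _ _ (begin
    zeros i (suc n) + suc (G (suc n) + G i)  ≡⟨ cong (λ y → zeros i (suc n) + y) e ⟨
    zeros i (suc n) + G (suc n + i)      ≡⟨ zeros-floor i (suc n) ⟩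
    suc n + G i                          ≡⟨ cong (λ x → suc x + G i) (zeros-1-floor n) ⟨
    suc (zeros 1 n + G (suc n) + G i)    ≡⟨ cong suc (+-assoc (zeros 1 n) _ _) ⟩
    suc (zeros 1 n + (G (suc n) + G i))  ≡⟨ +-suc (zeros 1 n) _ ⟨
    zeros 1 n + suc (G (suc n) + G i)    ∎)
    where open ≡-Reasoning

%2-bit : ∀ n → ∃ λ b → n % 2 ≡ bit b
%2-bit n with n % 2 | m%n<n n 2
... | 0 | _ = false , refl
... | 1 | _ = true , refl
... | suc (suc _) | s<s (s<s ())

bit-%2 : ∀ a → bit a % 2 ≡ bit a
bit-%2 false = refl
bit-%2 true = refl

bit-xor : ∀ a b → (bit a + bit b) % 2 ≡ bit (a xor b)
bit-xor false b = bit-%2 b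
bit-xor true false = refl
bit-xor true true = refl

%2-+ : ∀ {m n a b} → m % 2 ≡ bit a → n % 2 ≡ bit b → (m + n) % 2 ≡ bit (a xor b)
%2-+ {m} {n} {a} {b} p q = trans (%-distribˡ-+ m n 2) (trans (cong₂ (λ x y → (x + y) % 2) p q) (bit-xor a b))

-- `M` is the position just before a copy of the prefix of length `n`. For a factor starting at `M`,
-- `letter` decides whether it has the extra zero of `balanced`; `even-odd` counts the zeros through
-- `M`, hence all those before the copy.
record Return (n : ℕ) (ε b : Bool) : Set where
  field
    M : ℕ
    large : n < M
    letter : isZero M ≡ bit ε
    agree : ∀ j → 0 < j → j ≤ n → fib (M + j) ≡ fib j
    even-odd : zeros 1 M % 2 ≡ bit b

-- The step 6 rather than 3 also preserves the parity of the index, on which the letter depends.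
Fib-period : ∀ k j → Fib (k + j * 6) % 2 ≡ Fib k % 2
Fib-period k zero = cong (λ x → Fib x % 2) (+-identityʳ k)
Fib-period k (suc j) = trans (cong (λ x → Fib x % 2) (lem k (j * 6)))
  (trans (cong (_% 2) (lem′ (Fib (1 + (k + j * 6))) (Fib (k + j * 6))))
  (trans ([m+kn]%n≡m%n (Fib (k + j * 6)) (4 * Fib (1 + (k + j * 6)) + 2 * Fib (k + j * 6)) 2) (Fib-period k j)))
  where
  lem : ∀ k a → k + (6 + a) ≡ 6 + (k + a)
  lem = solve-∀
  lem′ : ∀ a b → (((a + b + a) + (a + b)) + (a + b + a)) + ((a + b + a) + (a + b)) ≡ b + (4 * a + 2 * b) * 2
  lem′ = solve-∀

module _ (n k : ℕ) (n<k : n < k) where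

  private
    M = Fib (2 + k)

    floor-after : ∀ j → j ≤ n → floorNα (M + suc j) ≡ Fib k + floorNα (suc j)
    floor-after j j≤n = floor-shift k (suc j) z<s (≤-<-trans j≤n n<k)

  agree-Fib : ∀ j → 0 < j → j ≤ n → fib (M + j) ≡ fib j
  agree-Fib (suc j) _ j<n = trans
    (cong₂ _∸_ (trans (cong floorNα (sym (+-suc M (suc j)))) (floor-after (suc j) j<n)) (floor-after j (<⇒≤ j<n)))
    ([m+n]∸[m+o]≡n∸o (Fib k) _ _)

  floor-suc-Fib : floorNα (suc M) ≡ Fib k
  floor-suc-Fib = trans (cong floorNα (+-comm 1 M)) (trans (floor-after 0 z≤n) (+-identityʳ _))

  zeros-Fib : zeros 1 M ≡ Fib (1 + k)
  zeros-Fib = +-cancelʳ-≡ (Fib k) _ _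
    (trans (cong (λ y → zeros 1 M + y) (sym floor-suc-Fib)) (zeros-1-floor M))

  -- As `⌊(M + 1) α⌋ = Fib k`, the first hypothesis is compared with `isZero-floor` at `M` and fixes
  -- the letter there.
  Fib-return : ∀ {ε b} → suc (floorNα M) ≡ bit ε + Fib k → Fib (1 + k) % 2 ≡ bit b → Return n ε b
  Fib-return {ε} ε-eq b-eq = record
    { M = M
    ; large = <-trans n<k (k<Fib[2+k] k)
    ; letter = +-cancelʳ-≡ (Fib k) _ _ (trans (cong (λ y → isZero M + y) (sym floor-suc-Fib)) (trans (isZero-floor M) ε-eq))
    ; agree = agree-Fib
    ; even-odd = trans (cong (_% 2) zeros-Fib) b-eq
    }

-- Fib has period 3 modulo 2, and the letter f[Fib (2 + k)] alternates with k.
return : ∀ n ε b → Return n ε b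
return n = λ where
    true true → Fib-return n (0 + j * 6) n<k (cong suc (even (j * 3) (lem₀ j))) (Fib-period 1 j)
    true false → Fib-return n (2 + j * 6) (≤-trans n<k (m≤n+m _ 2)) (cong suc (even (1 + j * 3) (lem₂ j))) (Fib-period 3 j)
    false true → Fib-return n (1 + j * 6) (≤-trans n<k (m≤n+m _ 1)) (odd (j * 3) (lem₁ j)) (Fib-period 2 j)
    false false → Fib-return n (5 + j * 6) (≤-trans n<k (m≤n+m _ 5)) (odd (2 + j * 3) (lem₅ j)) (Fib-period 6 j)
  where
  j = suc n
  n<k : n < j * 6
  n<k = m≤m*n (suc n) 6
  even : ∀ i {k} → i * 2 ≡ k → floorNα (Fib (2 + k)) ≡ Fib k
  even i refl = floor-Fib-even i
  odd : ∀ i {k} → 1 + i * 2 ≡ k → suc (floorNα (Fib (2 + k))) ≡ Fib k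
  odd i refl = suc-floor-Fib-odd i
  lem₀ : ∀ j → j * 3 * 2 ≡ j * 6
  lem₀ = solve-∀
  lem₁ : ∀ j → 1 + j * 3 * 2 ≡ 1 + j * 6
  lem₁ = solve-∀
  lem₂ : ∀ j → (1 + j * 3) * 2 ≡ 2 + j * 6
  lem₂ = solve-∀
  lem₅ : ∀ j → 1 + (2 + j * 3) * 2 ≡ 5 + j * 6
  lem₅ = solve-∀

-- Weights of factors

module Weights (S₀ S₁ S₂ : ℕ) where
  open Doubled S₀ S₁ S₂

  -- The doubled `F` has natural values, so its sums can be compared in ℕ.
  weight : ℕ → ℕ
  weight p = if fib p ≡ᵇ 0 then S₀ + S₂ else 2 * S₁

  C≡ : C ≡ + (S₀ + S₂)
  C≡ = lem s₀ s₁ s₂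
    where
    lem : ∀ a b c → (a ℤ.- + 2 ℤ.* b ℤ.+ c) ℤ.+ + 2 ℤ.* b ≡ a ℤ.+ c
    lem = ℤ-Solver.solve-∀

  F≡ : ∀ p → F p ≡ + weight p
  F≡ p with fib p ≡ᵇ 0
  ... | true = C≡
  ... | false = sym (ℤ.pos-* 2 S₁)

  mutual
    sumF≡ : ∀ i s → sumF i s ≡ + Σ[ weight ] i (suc s ∸ i)
    sumF≡ i s with suc s ∸ i
    ... | zero = refl
    ... | suc c with F i | weight i | F≡ i
    ...   | _ | _ | e with suc i
    ...     | p = cong₂ ℤ._+_ e (go≡′ i s c p)

    -- As in go≡, the hole is the local function of sumF.
    go≡′ : ∀ i s c p → _ ≡ + Σ[ weight ] p c
    go≡′ i s zero p = refl
    go≡′ i s (suc c) p = cong₂ ℤ._+_ (F≡ p) (go≡′ i s c (suc p))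

  -- The sum depends only on the length and the number of zeros. The ones number `c - zeros p c`;
  -- the subtraction is moved to the left side.
  weights-zeros : ∀ p c → Σ[ weight ] p c + zeros p c * (2 * S₁) ≡ zeros p c * (S₀ + S₂) + c * (2 * S₁)
  weights-zeros p zero = refl
  weights-zeros p (suc c) with fib p ≡ᵇ 0
  ... | true = lem (S₀ + S₂) (2 * S₁) (zeros (suc p) c) c _ (weights-zeros (suc p) c)
    where
    e₁ : ∀ t u z w → t + w + (u + z * u) ≡ t + u + (w + z * u)
    e₁ = solve-∀
    e₂ : ∀ t u z c → t + u + (z * t + c * u) ≡ t + z * t + (u + c * u)
    e₂ = solve-∀
    lem : ∀ t u z c w → w + z * u ≡ z * t + c * u → t + w + (u + z * u) ≡ t + z * t + (u + c * u)
    lem t u z c w eq = trans (e₁ t u z w) (trans (cong (λ x → t + u + x) eq) (e₂ t u z c))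
  ... | false = lem (S₀ + S₂) (2 * S₁) (zeros (suc p) c) c _ (weights-zeros (suc p) c)
    where
    e₂ : ∀ t u z c → u + (z * t + c * u) ≡ z * t + (u + c * u)
    e₂ = solve-∀
    lem : ∀ t u z c w → w + z * u ≡ z * t + c * u → u + w + z * u ≡ z * t + (u + c * u)
    lem t u z c w eq = trans (+-assoc u w _) (trans (cong (λ x → u + x) eq) (e₂ t u z c))

  D : ℤ
  D = s₀ ℤ.- s₂

  -- The letters 0 and 2 alternate, so their deviations ±D/2 from the mean telescope.
  letter-weight : ∀ n {a b} → zeros 1 n % 2 ≡ bit a → zeros 1 (suc n) % 2 ≡ bit b →
    + 2 ℤ.* + Sletter S₀ S₁ S₂ (tw (suc n)) ℤ.+ D ℤ.* + bit a ≡ + weight (suc n) ℤ.+ D ℤ.* + bit b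
  letter-weight n {a} {b} a-eq b-eq with fib (suc n) ≡ᵇ 0 | Σ-snoc isZero n
  ... | false | e = cong₂ (λ x y → x ℤ.+ D ℤ.* + y) (sym (ℤ.pos-* 2 S₁))
    (trans (sym a-eq) (trans (cong (_% 2) (sym (trans e (+-identityʳ _)))) b-eq))
  -- `tw` reads the parity through the letter itself: odd gives 0, even gives 2. The last equation
  -- makes this parity opposite to `a`, which removes two of the four cases.
  ... | true | e with zerosIn 1 (suc n) % 2 | trans (cong (_% 2) (zerosIn≡zeros 1 (suc n))) b-eq
                    | trans (sym (%2-+ {zeros 1 n} {1} {a} {true} a-eq refl)) (trans (cong (_% 2) (sym e)) b-eq)
  letter-weight n {false} {true} _ _ | true | _ | _ | refl | _ = lem s₀ s₂
    where
    lem : ∀ x y → + 2 ℤ.* x ℤ.+ (x ℤ.- y) ℤ.* + 0 ≡ (x ℤ.+ y) ℤ.+ (x ℤ.- y) ℤ.* + 1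
    lem = ℤ-Solver.solve-∀
  letter-weight n {true} {false} _ _ | true | _ | _ | refl | _ = lem s₀ s₂
    where
    lem : ∀ x y → + 2 ℤ.* y ℤ.+ (x ℤ.- y) ℤ.* + 1 ≡ (x ℤ.+ y) ℤ.+ (x ℤ.- y) ℤ.* + 0
    lem = ℤ-Solver.solve-∀
  letter-weight n {true} {true} _ _ | true | _ | _ | refl | ()
  letter-weight n {false} {false} _ _ | true | _ | _ | refl | ()

  factor-weight : ∀ n len {a b} → zeros 1 n % 2 ≡ bit a → zeros 1 (n + len) % 2 ≡ bit b →
    + 2 ℤ.* + Sfactor S₀ S₁ S₂ (suc n) len ℤ.+ D ℤ.* + bit a ≡ + Σ[ weight ] (suc n) len ℤ.+ D ℤ.* + bit b
  factor-weight n zero a-eq b-eq = cong (λ x → + 0 ℤ.+ D ℤ.* + x)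
    (trans (sym a-eq) (trans (cong (λ x → zeros 1 x % 2) (sym (+-identityʳ n))) b-eq))
  factor-weight n (suc len) {a} {b} a-eq b-eq with %2-bit (zeros 1 (suc n))
  ... | c , c-eq = ∙-cancelʳ (D ℤ.* + bit c) _ _ (begin
    + 2 ℤ.* (+ x ℤ.+ + y) ℤ.+ D ℤ.* + bit a ℤ.+ D ℤ.* + bit c
      ≡⟨ e₁ (+ x) (+ y) (D ℤ.* + bit a) (D ℤ.* + bit c) ⟩
    (+ 2 ℤ.* + x ℤ.+ D ℤ.* + bit a) ℤ.+ (+ 2 ℤ.* + y ℤ.+ D ℤ.* + bit c)
      ≡⟨ cong₂ ℤ._+_ (letter-weight n a-eq c-eq) (factor-weight (suc n) len c-eq b-eq′) ⟩
    (+ weight (suc n) ℤ.+ D ℤ.* + bit c) ℤ.+ (+ Σ[ weight ] (2 + n) len ℤ.+ D ℤ.* + bit b)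
      ≡⟨ e₂ (+ weight (suc n)) (D ℤ.* + bit c) (+ Σ[ weight ] (2 + n) len) (D ℤ.* + bit b) ⟩
    (+ weight (suc n) ℤ.+ + Σ[ weight ] (2 + n) len) ℤ.+ D ℤ.* + bit b ℤ.+ D ℤ.* + bit c ∎)
    where
    open ≡-Reasoning
    x = Sletter S₀ S₁ S₂ (tw (suc n))
    y = Sfactor S₀ S₁ S₂ (2 + n) len
    b-eq′ : zeros 1 (suc n + len) % 2 ≡ bit b
    b-eq′ = trans (cong (λ x → zeros 1 x % 2) (sym (+-suc n len))) b-eq
    e₁ : ∀ x y a c → + 2 ℤ.* (x ℤ.+ y) ℤ.+ a ℤ.+ c ≡ (+ 2 ℤ.* x ℤ.+ a) ℤ.+ (+ 2 ℤ.* y ℤ.+ c)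
    e₁ = ℤ-Solver.solve-∀
    e₂ : ∀ w c w′ b → (w ℤ.+ c) ℤ.+ (w′ ℤ.+ b) ≡ (w ℤ.+ w′) ℤ.+ b ℤ.+ c
    e₂ = ℤ-Solver.solve-∀

  -- 2 (F[i] + ⋯ + F[i + c - 1]) plus 2o_r or 2e_r according to the parity b.
  value : ℕ → ℕ → ℕ → ℕ → ℤ
  value i c b r = + Σ[ weight ] i c ℤ.+ E r ℤ.+ (O r ℤ.- E r) ℤ.* + b

  -- The index r realised by a factor of length s + 1: a and b are the parities of the numbers
  -- of zeros before it and in f[1, s], and ε tells whether it has more zeros than f[1, s].
  index : (ε a b : Bool) → ℕ
  index false a false = 2
  index false false true = 1
  index false true true = 2
  index true a true = 0
  index true false false = 0
  index true true false = 1

  index<3 : ∀ ε a b → index ε a b < 3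
  index<3 false a false = s≤s (s≤s (s≤s z≤n))
  index<3 false false true = s≤s (s≤s z≤n)
  index<3 false true true = s≤s (s≤s (s≤s z≤n))
  index<3 true a true = s≤s z≤n
  index<3 true false false = s≤s z≤n
  index<3 true true false = s≤s (s≤s z≤n)

  -- For the converse inclusion: whatever the parity of `|f[1, s]|₀`, all three offsets come from
  -- some `ε` and `a`.
  index-surjective : ∀ b {r} → r < 3 → ∃₂ λ ε a → index ε a b ≡ r
  index-surjective false {0} _ = true , false , refl
  index-surjective false {1} _ = true , true , refl
  index-surjective false {2} _ = false , false , refl
  index-surjective true {0} _ = true , false , refl
  index-surjective true {1} _ = false , false , refl
  index-surjective true {2} _ = false , true , refl
  index-surjective _ {suc (suc (suc _))} (s≤s (s≤s (s≤s ())))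

  -- By `ε-eq` the sum of `weight` over the factor is that over `f[1, s]` and one more letter, a 0
  -- if `ε` is true and a 1 otherwise; `factor-weight` adds `D` times the change of parity. In each
  -- of the eight cases the excess over `f[1, s]` is `2 * S₁` plus the offset selected by `index`.
  factor-value : ∀ n s ε {a b} → zeros 1 n % 2 ≡ bit a → zeros 1 s % 2 ≡ bit b →
    zeros (suc n) (suc s) ≡ bit ε + zeros 1 s →
    + 2 ℤ.* + Sfactor S₀ S₁ S₂ (suc n) (suc s) ≡ + 2 ℤ.* s₁ ℤ.+ value 1 s (bit b) (index ε a b)
  factor-value n s ε {a} {b} a-eq b-eq ε-eq = ∙-cancelʳ (D ℤ.* + bit a) _ _
    (trans (factor-weight n (suc s) a-eq c-eq) (trans (cong (λ x → x ℤ.+ D ℤ.* + bit (a xor (ε xor b))) sum≡) (table ε a b (+ Σ[ weight ] 1 s))))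
    where
    c-eq : zeros 1 (n + suc s) % 2 ≡ bit (a xor (ε xor b))
    c-eq = trans (cong (_% 2) (trans (Σ-1-+ isZero n (suc s)) (cong (λ x → zeros 1 n + x) ε-eq)))
      (%2-+ {zeros 1 n} {bit ε + zeros 1 s} {a} a-eq (%2-+ {bit ε} {zeros 1 s} (bit-%2 ε) b-eq))
    gain : Bool → ℕ
    gain false = 2 * S₁
    gain true = S₀ + S₂
    sumℕ : Σ[ weight ] (suc n) (suc s) ≡ Σ[ weight ] 1 s + gain ε
    sumℕ = +-cancelʳ-≡ (zeros (suc n) (suc s) * (2 * S₁)) _ _ (trans (weights-zeros (suc n) (suc s))
      (trans (cong (λ z → z * (S₀ + S₂) + suc s * (2 * S₁)) ε-eq)
      (trans (step ε) (cong (λ z → Σ[ weight ] 1 s + gain ε + z * (2 * S₁)) (sym ε-eq)))))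
      where
      e₁ : ∀ z t u s → z * t + (u + s * u) ≡ (z * t + s * u) + u
      e₁ = solve-∀
      e₂ : ∀ z t u s → (t + z * t) + (u + s * u) ≡ (z * t + s * u) + (t + u)
      e₂ = solve-∀
      e₃ : ∀ w z u → w + z * u + u ≡ w + u + z * u
      e₃ = solve-∀
      e₄ : ∀ w z t u → w + z * u + (t + u) ≡ w + t + (u + z * u)
      e₄ = solve-∀
      step : ∀ ε → (bit ε + zeros 1 s) * (S₀ + S₂) + suc s * (2 * S₁) ≡ Σ[ weight ] 1 s + gain ε + (bit ε + zeros 1 s) * (2 * S₁)
      step false = trans (e₁ (zeros 1 s) (S₀ + S₂) (2 * S₁) s) (trans (cong (λ x → x + 2 * S₁) (sym (weights-zeros 1 s))) (e₃ (Σ[ weight ] 1 s) (zeros 1 s) (2 * S₁)))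
      step true = trans (e₂ (zeros 1 s) (S₀ + S₂) (2 * S₁) s) (trans (cong (λ x → x + (S₀ + S₂ + 2 * S₁)) (sym (weights-zeros 1 s))) (e₄ (Σ[ weight ] 1 s) (zeros 1 s) (S₀ + S₂) (2 * S₁)))
    gainℤ : Bool → ℤ
    gainℤ false = + 2 ℤ.* s₁
    gainℤ true = s₀ ℤ.+ s₂
    gain≡ : ∀ ε → + gain ε ≡ gainℤ ε
    gain≡ false = ℤ.pos-* 2 S₁
    gain≡ true = refl
    sum≡ : + Σ[ weight ] (suc n) (suc s) ≡ + Σ[ weight ] 1 s ℤ.+ gainℤ ε
    sum≡ = trans (cong +_ sumℕ) (cong (λ x → + Σ[ weight ] 1 s ℤ.+ x) (gain≡ ε))
    table : ∀ ε a b w → w ℤ.+ gainℤ ε ℤ.+ D ℤ.* + bit (a xor (ε xor b)) ≡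
      + 2 ℤ.* s₁ ℤ.+ (w ℤ.+ E (index ε a b) ℤ.+ (O (index ε a b) ℤ.- E (index ε a b)) ℤ.* + bit b) ℤ.+ D ℤ.* + bit a
    table false false false = lem s₀ s₁ s₂
      where
      lem : ∀ x y z w → w ℤ.+ + 2 ℤ.* y ℤ.+ (x ℤ.- z) ℤ.* + 0 ≡
        + 2 ℤ.* y ℤ.+ (w ℤ.+ + 0 ℤ.+ ((z ℤ.- x) ℤ.- + 0) ℤ.* + 0) ℤ.+ (x ℤ.- z) ℤ.* + 0
      lem = ℤ-Solver.solve-∀
    table false false true = lem s₀ s₁ s₂
      where
      lem : ∀ x y z w → w ℤ.+ + 2 ℤ.* y ℤ.+ (x ℤ.- z) ℤ.* + 1 ≡
        + 2 ℤ.* y ℤ.+ (w ℤ.+ (+ 2 ℤ.* (z ℤ.- y)) ℤ.+ ((x ℤ.- z) ℤ.- (+ 2 ℤ.* (z ℤ.- y))) ℤ.* + 1) ℤ.+ (x ℤ.- z) ℤ.* + 0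
      lem = ℤ-Solver.solve-∀
    table false true false = lem s₀ s₁ s₂
      where
      lem : ∀ x y z w → w ℤ.+ + 2 ℤ.* y ℤ.+ (x ℤ.- z) ℤ.* + 1 ≡
        + 2 ℤ.* y ℤ.+ (w ℤ.+ + 0 ℤ.+ ((z ℤ.- x) ℤ.- + 0) ℤ.* + 0) ℤ.+ (x ℤ.- z) ℤ.* + 1
      lem = ℤ-Solver.solve-∀
    table false true true = lem s₀ s₁ s₂
      where
      lem : ∀ x y z w → w ℤ.+ + 2 ℤ.* y ℤ.+ (x ℤ.- z) ℤ.* + 0 ≡
        + 2 ℤ.* y ℤ.+ (w ℤ.+ + 0 ℤ.+ ((z ℤ.- x) ℤ.- + 0) ℤ.* + 1) ℤ.+ (x ℤ.- z) ℤ.* + 1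
      lem = ℤ-Solver.solve-∀
    table true false false = lem s₀ s₁ s₂
      where
      lem : ∀ x y z w → w ℤ.+ (x ℤ.+ z) ℤ.+ (x ℤ.- z) ℤ.* + 1 ≡
        + 2 ℤ.* y ℤ.+ (w ℤ.+ (+ 2 ℤ.* (x ℤ.- y)) ℤ.+ ((x ℤ.- + 2 ℤ.* y ℤ.+ z) ℤ.- (+ 2 ℤ.* (x ℤ.- y))) ℤ.* + 0) ℤ.+ (x ℤ.- z) ℤ.* + 0
      lem = ℤ-Solver.solve-∀
    table true false true = lem s₀ s₁ s₂
      where
      lem : ∀ x y z w → w ℤ.+ (x ℤ.+ z) ℤ.+ (x ℤ.- z) ℤ.* + 0 ≡
        + 2 ℤ.* y ℤ.+ (w ℤ.+ (+ 2 ℤ.* (x ℤ.- y)) ℤ.+ ((x ℤ.- + 2 ℤ.* y ℤ.+ z) ℤ.- (+ 2 ℤ.* (x ℤ.- y))) ℤ.* + 1) ℤ.+ (x ℤ.- z) ℤ.* + 0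
      lem = ℤ-Solver.solve-∀
    table true true false = lem s₀ s₁ s₂
      where
      lem : ∀ x y z w → w ℤ.+ (x ℤ.+ z) ℤ.+ (x ℤ.- z) ℤ.* + 0 ≡
        + 2 ℤ.* y ℤ.+ (w ℤ.+ (+ 2 ℤ.* (z ℤ.- y)) ℤ.+ ((x ℤ.- z) ℤ.- (+ 2 ℤ.* (z ℤ.- y))) ℤ.* + 0) ℤ.+ (x ℤ.- z) ℤ.* + 1
      lem = ℤ-Solver.solve-∀
    table true true true = lem s₀ s₁ s₂
      where
      lem : ∀ x y z w → w ℤ.+ (x ℤ.+ z) ℤ.+ (x ℤ.- z) ℤ.* + 1 ≡
        + 2 ℤ.* y ℤ.+ (w ℤ.+ (+ 2 ℤ.* (x ℤ.- y)) ℤ.+ ((x ℤ.- + 2 ℤ.* y ℤ.+ z) ℤ.- (+ 2 ℤ.* (x ℤ.- y))) ℤ.* + 1) ℤ.+ (x ℤ.- z) ℤ.* + 1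
      lem = ℤ-Solver.solve-∀

-- Gaps

i≤∣i∣ : ∀ i → i ℤ.≤ + ∣ i ∣
i≤∣i∣ (+ n) = ℤ.≤-refl
i≤∣i∣ -[1+ n ] = ℤ.-≤+

module _ {x w k : ℕ} {j : ℤ} (eq : + x ≡ + w ℤ.+ j) (∣j∣≤k : ∣ j ∣ ≤ k) where

  upper-bound : x ≤ w + k
  upper-bound = ℤ.drop‿+≤+ (subst (ℤ._≤ + (w + k)) (sym eq)
    (ℤ.+-monoʳ-≤ (+ w) (ℤ.≤-trans (i≤∣i∣ j) (ℤ.+≤+ ∣j∣≤k))))

  lower-bound : w ≤ x + k
  lower-bound = ℤ.drop‿+≤+ (subst (ℤ._≤ + (x + k)) (trans (cong (λ y → y ℤ.+ ℤ.- j) eq) (lem (+ w) j))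
    (ℤ.+-monoʳ-≤ (+ x) (ℤ.≤-trans (i≤∣i∣ (ℤ.- j)) (ℤ.+≤+ (≤-trans (≤-reflexive (ℤ.∣-i∣≡∣i∣ j)) ∣j∣≤k)))))
    where
    lem : ∀ w j → w ℤ.+ j ℤ.+ ℤ.- j ≡ w
    lem = ℤ-Solver.solve-∀

+-≤-⇔ : ∀ a b c → (+ a ℤ.≤ + b ℤ.- + c) ⇔ (a + c ≤ b)
+-≤-⇔ a b c = mk⇔
  (λ h → ℤ.drop‿+≤+ (subst (+ (a + c) ℤ.≤_) (e (+ b) (+ c)) (ℤ.+-monoˡ-≤ (+ c) h)))
  (λ h → subst (ℤ._≤ + b ℤ.- + c) (e′ (+ a) (+ c)) (ℤ.+-monoˡ-≤ (ℤ.- + c) (ℤ.+≤+ h)))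
  where
  e : ∀ b c → b ℤ.- c ℤ.+ c ≡ b
  e = ℤ-Solver.solve-∀
  e′ : ∀ a c → a ℤ.+ c ℤ.- c ≡ a
  e′ = ℤ-Solver.solve-∀

module Proof (S₀ S₁ S₂ : ℕ) (1≤S₀ : 1 ≤ S₀) (1≤S₁ : 1 ≤ S₁) (1≤S₂ : 1 ≤ S₂) where
  open Doubled S₀ S₁ S₂
  open Weights S₀ S₁ S₂

  ∣E∣≤kk : ∀ r → ∣ E r ∣ ≤ kk
  ∣E∣≤kk 0 = ≤-trans (≤-trans (m≤n⊔m (∣ K₁ ∣ ⊔ ∣ K₂ ∣ ⊔ ∣ K₃ ∣) ∣ K₄ ∣) (m≤m⊔n _ ∣ K₅ ∣)) (m≤m⊔n _ ∣ K₆ ∣)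
  ∣E∣≤kk 1 = ≤-trans (m≤n⊔m (∣ K₁ ∣ ⊔ ∣ K₂ ∣ ⊔ ∣ K₃ ∣ ⊔ ∣ K₄ ∣) ∣ K₅ ∣) (m≤m⊔n _ ∣ K₆ ∣)
  ∣E∣≤kk (suc (suc _)) = z≤n

  ∣O∣≤kk : ∀ r → ∣ O r ∣ ≤ kk
  ∣O∣≤kk r = ≤-trans (go r) (≤-trans (m≤m⊔n _ ∣ K₄ ∣) (≤-trans (m≤m⊔n _ ∣ K₅ ∣) (m≤m⊔n _ ∣ K₆ ∣)))
    where
    go : ∀ r → ∣ O r ∣ ≤ ∣ K₁ ∣ ⊔ ∣ K₂ ∣ ⊔ ∣ K₃ ∣
    go 0 = ≤-trans (m≤m⊔n ∣ K₁ ∣ ∣ K₂ ∣) (m≤m⊔n _ ∣ K₃ ∣)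
    go 1 = ≤-trans (m≤n⊔m ∣ K₁ ∣ ∣ K₂ ∣) (m≤m⊔n _ ∣ K₃ ∣)
    go (suc (suc _)) = m≤n⊔m (∣ K₁ ∣ ⊔ ∣ K₂ ∣) ∣ K₃ ∣

  -- Describes the positive values of S on factors by `s` and `r` alone; `InSL⇒represents` and
  -- `represents⇒InSL` are the two directions.
  Represents : ℕ → ℕ → ℕ → Set
  Represents n s r = + 2 ℤ.* + n ≡ + 2 ℤ.* s₁ ℤ.+ value 1 s (zeros 1 s % 2) r

  -- The parity selects `E r` or `O r`, and `kk` bounds both.
  represents-bounds : ∀ {n s r} → Represents n s r →
    2 * n ≤ 2 * S₁ + Σ[ weight ] 1 s + kk × 2 * S₁ + Σ[ weight ] 1 s ≤ 2 * n + kk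
  represents-bounds {n} {s} {r} eq with %2-bit (zeros 1 s)
  ... | b , b-eq = upper-bound {j = j b} eq′ (∣j∣≤kk b) , lower-bound {j = j b} eq′ (∣j∣≤kk b)
    where
    j : Bool → ℤ
    j false = E r
    j true = O r
    ∣j∣≤kk : ∀ b → ∣ j b ∣ ≤ kk
    ∣j∣≤kk false = ∣E∣≤kk r
    ∣j∣≤kk true = ∣O∣≤kk r
    lem : ∀ b u w → u ℤ.+ (w ℤ.+ E r ℤ.+ (O r ℤ.- E r) ℤ.* + bit b) ≡ u ℤ.+ w ℤ.+ j b
    lem false u w = lem′ u w (E r) (O r)
      where
      lem′ : ∀ u w e o → u ℤ.+ (w ℤ.+ e ℤ.+ (o ℤ.- e) ℤ.* + 0) ≡ u ℤ.+ w ℤ.+ e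
      lem′ = ℤ-Solver.solve-∀
    lem true u w = lem′ u w (E r) (O r)
      where
      lem′ : ∀ u w e o → u ℤ.+ (w ℤ.+ e ℤ.+ (o ℤ.- e) ℤ.* + 1) ≡ u ℤ.+ w ℤ.+ o
      lem′ = ℤ-Solver.solve-∀
    eq′ : + (2 * n) ≡ + (2 * S₁ + Σ[ weight ] 1 s) ℤ.+ j b
    eq′ = trans (ℤ.pos-* 2 n) (trans eq (trans (cong (λ p → + 2 ℤ.* s₁ ℤ.+ value 1 s p r) b-eq)
      (trans (cong (λ u → u ℤ.+ value 1 s (bit b) r) (sym (ℤ.pos-* 2 S₁))) (lem b (+ (2 * S₁)) (+ Σ[ weight ] 1 s)))))

  InSL⇒represents : ∀ {n} → 1 ≤ n → InSL S₀ S₁ S₂ n → ∃₂ λ s r → r < 3 × Represents n s r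
  InSL⇒represents () (factor i zero _ refl)
  InSL⇒represents _ (factor (suc n) (suc s) _ refl) with balanced (suc n) s | %2-bit (zeros 1 n) | %2-bit (zeros 1 s)
  ... | ε , ε-eq | a , a-eq | b , b-eq = s , index ε a b , index<3 ε a b ,
    trans (factor-value n s ε a-eq b-eq ε-eq) (cong (λ p → + 2 ℤ.* s₁ ℤ.+ value 1 s p (index ε a b)) (sym b-eq))

  xor-cancelʳ : ∀ a b c → a xor c ≡ b xor c → a ≡ b
  xor-cancelʳ false false c _ = refl
  xor-cancelʳ true true c _ = refl
  xor-cancelʳ false true false ()
  xor-cancelʳ false true true ()
  xor-cancelʳ true false false ()
  xor-cancelʳ true false true ()

  bit-injective : ∀ {a b} → bit a ≡ bit b → a ≡ b
  bit-injective {false} {false} _ = refl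
  bit-injective {true} {true} _ = refl

  -- `index-surjective` chooses `ε` and `a` for the given `r`; the factor realising them starts at
  -- the position `M` of a return and continues through the copy of `f[1, s]`.
  represents⇒InSL : ∀ {n s r} → r < 3 → Represents n s r → InSL S₀ S₁ S₂ n
  represents⇒InSL {n} {s} {r} r<3 eq with %2-bit (zeros 1 s)
  ... | b , b-eq with index-surjective b r<3
  -- The return counts the zeros through `M` while `a` counts those before it, hence the parity
  -- `a xor ε`.
  ...   | ε , a , refl with return s ε (a xor ε)
  ...     | record { M = suc m ; large = large ; letter = letter ; agree = agree ; even-odd = even-odd } =
    factor (suc m) (suc s) (s≤s z≤n) (ℤ.+-injective (ℤ.*-cancelˡ-≡ (+ 2) _ _
      (trans (factor-value m s ε a-eq b-eq (cong₂ _+_ letter (Σ-cong s λ o o<s → cong (λ z → if z ≡ᵇ 0 then 1 else 0) (trans (cong fib (sym (+-suc (suc m) o))) (agree (suc o) z<s o<s)))))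
        (trans (cong (λ p → + 2 ℤ.* s₁ ℤ.+ value 1 s p (index ε a b)) (sym b-eq)) (sym eq)))))
    where
    a-eq : zeros 1 m % 2 ≡ bit a
    a-eq with %2-bit (zeros 1 m)
    ... | a′ , a′-eq = trans a′-eq (cong bit (xor-cancelʳ a′ a ε (bit-injective (trans
      (sym (%2-+ {zeros 1 m} {isZero (suc m)} {a′} {ε} a′-eq (trans (cong (_% 2) letter) (bit-%2 ε))))
      (trans (cong (_% 2) (sym (Σ-snoc isZero m))) even-odd)))))

  -- Each 1 contributes `2 * S₁` and each pair of zeros `2 * (S₀ + S₂)`, so at most one zero is left
  -- over. The half `h` is the integral translation from a window to the word; the leftover is the
  -- shift `k₁ + S₁` in 𝕂¹, doubled.
  half : ∀ n {b} → zeros 1 n % 2 ≡ bit b → ∃ λ h → Σ[ weight ] 1 n ≡ 2 * h + bit b * (S₀ + S₂)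
  half zero {false} _ = 0 , refl
  half (suc n) {b} b-eq with %2-bit (zeros 1 n)
  ... | a , a-eq with half n a-eq
  ...   | h , h-eq with fib (suc n) ≡ᵇ 0 | Σ-snoc weight n | Σ-snoc isZero n
  ...     | false | w-eq | z-eq = h + S₁ , (begin
    Σ[ weight ] 1 (suc n)                   ≡⟨ trans w-eq (cong (λ x → x + 2 * S₁) h-eq) ⟩
    2 * h + bit a * (S₀ + S₂) + 2 * S₁      ≡⟨ lem h (bit a) (S₀ + S₂) S₁ ⟩
    2 * (h + S₁) + bit a * (S₀ + S₂)        ≡⟨ cong (λ x → 2 * (h + S₁) + x * (S₀ + S₂)) a≡b ⟩
    2 * (h + S₁) + bit b * (S₀ + S₂)        ∎)
    where
    open ≡-Reasoning
    lem : ∀ h a t u → 2 * h + a * t + 2 * u ≡ 2 * (h + u) + a * t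
    lem = solve-∀
    a≡b : bit a ≡ bit b
    a≡b = trans (sym a-eq) (trans (cong (_% 2) (sym (trans z-eq (+-identityʳ _)))) b-eq)
  ...     | true | w-eq | z-eq with bit-injective {b} {a xor true} (trans (sym b-eq) (trans (cong (_% 2) z-eq) (%2-+ {zeros 1 n} {1} {a} {true} a-eq refl)))
  half (suc n) _ | false , a-eq | h , h-eq | true | w-eq | z-eq | refl =
    h , trans w-eq (trans (cong (λ x → x + (S₀ + S₂)) h-eq) (lem h (S₀ + S₂)))
    where
    lem : ∀ h t → 2 * h + 0 + t ≡ 2 * h + (t + 0)
    lem = solve-∀
  half (suc n) _ | true , a-eq | h , h-eq | true | w-eq | z-eq | refl =
    h + (S₀ + S₂) , trans w-eq (trans (cong (λ x → x + (S₀ + S₂)) h-eq) (lem h (S₀ + S₂)))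
    where
    lem : ∀ h t → 2 * h + (t + 0) + t ≡ 2 * (h + t) + 0
    lem = solve-∀

  -- The conditions on 𝕂⁰ (β = false) and 𝕂¹ (β = true); β is the parity of the number of zeros
  -- that precede the window in the word.
  low : Bool → ℤ
  low false = + (kk + 2)
  low true = C ℤ.+ + (kk + 2)

  high : Bool → ℕ → ℤ
  high false i = sumF i (i + l) ℤ.- + (kk + 2)
  high true i = C ℤ.+ (sumF i (i + l) ℤ.- + (kk + 2))

  sig : Bool → ℕ → ℕ → ℕ → ℤ
  sig false i s r = sig0 i s r
  sig true i s r = C ℤ.+ sig1 i s r

  Hit : Bool → ℕ → ℕ → Set
  Hit β i x = Σ ℕ (λ r → Σ ℕ (λ s → r < 3 × i ≤ s × s ≤ i + l ∸ 1 × + 2 ℤ.* (+ x) ≡ sig β i s r))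

  Gap : Bool → ℕ → ℕ → Set
  Gap β i x = (low β ℤ.≤ + 2 ℤ.* (+ x)) × (+ 2 ℤ.* (+ x) ℤ.≤ high β i) × ¬ Hit β i x

  C-term : ∀ β → ℤ
  C-term β = + (bit β * (S₀ + S₂))

  C-term-true : C ≡ C-term true
  C-term-true = trans C≡ (cong +_ (sym (+-identityʳ _)))

  low-⇔ : ∀ β x → (low β ℤ.≤ + 2 ℤ.* (+ x)) ⇔ (bit β * (S₀ + S₂) + (kk + 2) ≤ 2 * x)
  low-⇔ β x = mk⇔ (ℤ.drop‿+≤+ ∘ subst₂ ℤ._≤_ (low≡ β) (sym (ℤ.pos-* 2 x)))
    (subst₂ ℤ._≤_ (sym (low≡ β)) (ℤ.pos-* 2 x) ∘ ℤ.+≤+)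
    where
    low≡ : ∀ β → low β ≡ + (bit β * (S₀ + S₂) + (kk + 2))
    low≡ false = refl
    low≡ true = cong (λ c → c ℤ.+ + (kk + 2)) C-term-true

  -- The interval sums up to `j + 1 = i + l`, hence over `l + 1` letters, while the `s` in `Hit`
  -- stop at `j`.
  high-⇔ : ∀ β n x → (+ 2 ℤ.* (+ x) ℤ.≤ high β (suc n)) ⇔
    (2 * x + (kk + 2) ≤ bit β * (S₀ + S₂) + Σ[ weight ] (suc n) (suc l))
  high-⇔ β n x = subst₂ (λ u v → (u ℤ.≤ v) ⇔ (2 * x + (kk + 2) ≤ bit β * (S₀ + S₂) + Σ[ weight ] (suc n) (suc l))) (ℤ.pos-* 2 x) (sym (high≡ β)) (+-≤-⇔ (2 * x) _ (kk + 2))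
    where
    W : ℤ
    W = + Σ[ weight ] (suc n) (suc l)
    sumF≡W : sumF (suc n) (suc n + l) ≡ W
    sumF≡W = trans (sumF≡ (suc n) (suc n + l)) (cong (λ c → + Σ[ weight ] (suc n) c)
      (trans (cong (_∸ n) (sym (+-suc n l))) (m+n∸m≡n n (suc l))))
    high≡ : ∀ β → high β (suc n) ≡ + (bit β * (S₀ + S₂) + Σ[ weight ] (suc n) (suc l)) ℤ.- + (kk + 2)
    high≡ false = cong (λ w → w ℤ.- + (kk + 2)) sumF≡W
    high≡ true = trans (cong₂ (λ c w → c ℤ.+ (w ℤ.- + (kk + 2))) C-term-true sumF≡W)
      (sym (ℤ.+-assoc (C-term true) W (ℤ.- + (kk + 2))))

  -- One formula for both cases: `1 - par` is the parity with one zero added, which accounts for an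
  -- odd number of zeros before the window.
  sig≡ : ∀ β n c r → sig β (suc n) (n + c) r ≡ C-term β ℤ.+ value (suc n) c ((bit β + zeros (suc n) c) % 2) r
  sig≡ β n c r = by β
    where
    count≡ : suc (n + c) ∸ suc n ≡ c
    count≡ = m+n∸m≡n n c
    sumF≡′ : sumF (suc n) (n + c) ≡ + Σ[ weight ] (suc n) c
    sumF≡′ = trans (sumF≡ (suc n) (n + c)) (cong (λ k → + Σ[ weight ] (suc n) k) count≡)
    par≡ : par (suc n) (n + c) ≡ + (zeros (suc n) c % 2)
    par≡ = cong (λ k → + (k % 2)) (trans (zerosIn≡zeros (suc n) (n + c)) (cong (zeros (suc n)) count≡))
    flip : + 1 ℤ.- + (zeros (suc n) c % 2) ≡ + ((1 + zeros (suc n) c) % 2)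
    flip with %2-bit (zeros (suc n) c)
    ... | b , b-eq = trans (cong (λ p → + 1 ℤ.- + p) b-eq)
      (trans (not-bit b) (cong +_ (sym (%2-+ {1} {zeros (suc n) c} {true} {b} refl b-eq))))
      where
      not-bit : ∀ b → + 1 ℤ.- + bit b ≡ + bit (true xor b)
      not-bit false = refl
      not-bit true = refl
    by : ∀ β → sig β (suc n) (n + c) r ≡ C-term β ℤ.+ value (suc n) c ((bit β + zeros (suc n) c) % 2) r
    by false = trans (cong₂ (λ w p → w ℤ.+ E r ℤ.+ (O r ℤ.- E r) ℤ.* p) sumF≡′ par≡) (sym (ℤ.+-identityˡ _))
    by true = cong₂ ℤ._+_ C-term-true
      (cong₂ (λ w p → w ℤ.+ E r ℤ.+ (O r ℤ.- E r) ℤ.* p) sumF≡′ (trans (cong (λ p → + 1 ℤ.- p) par≡) flip))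

  value-+ : ∀ n c r {β} → zeros 1 n % 2 ≡ bit β →
    value 1 (n + c) (zeros 1 (n + c) % 2) r ≡ + Σ[ weight ] 1 n ℤ.+ value (suc n) c ((bit β + zeros (suc n) c) % 2) r
  value-+ n c r {β} β-eq = trans (cong₂ (λ w p → + w ℤ.+ E r ℤ.+ (O r ℤ.- E r) ℤ.* + p) (Σ-1-+ weight n c) parity≡)
    (lem (+ Σ[ weight ] 1 n) (+ Σ[ weight ] (suc n) c) (E r) _)
    where
    parity≡ : zeros 1 (n + c) % 2 ≡ (bit β + zeros (suc n) c) % 2
    parity≡ with %2-bit (zeros (suc n) c)
    ... | b , b-eq = trans (cong (_% 2) (Σ-1-+ isZero n c)) (trans (%2-+ {zeros 1 n} {zeros (suc n) c} {β} β-eq b-eq)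
      (sym (%2-+ {bit β} {zeros (suc n) c} {β} (bit-%2 β) b-eq)))
    lem : ∀ w w′ e d → (w ℤ.+ w′) ℤ.+ e ℤ.+ d ≡ w ℤ.+ (w′ ℤ.+ e ℤ.+ d)
    lem = ℤ-Solver.solve-∀

  -- The prefix of length `n` contributes `2 * h` and the leftover `C-term β`, so translation by
  -- `S₁ + h` carries the integers of the window to integers of the word.
  represents-⇔ : ∀ n c r h x {β} → zeros 1 n % 2 ≡ bit β → Σ[ weight ] 1 n ≡ 2 * h + bit β * (S₀ + S₂) →
    Represents (S₁ + h + x) (n + c) r ⇔ (+ 2 ℤ.* + x ≡ C-term β ℤ.+ value (suc n) c ((bit β + zeros (suc n) c) % 2) r)
  represents-⇔ n c r h x {β} β-eq h-eq = mk⇔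
    (λ eq → ∙-cancelˡ u _ _ (trans (sym lhs≡) (trans eq rhs≡)))
    (λ eq → trans lhs≡ (trans (cong (λ y → u ℤ.+ y) eq) (sym rhs≡)))
    where
    u v : ℤ
    u = + 2 ℤ.* s₁ ℤ.+ + 2 ℤ.* + h
    v = value (suc n) c ((bit β + zeros (suc n) c) % 2) r
    lhs≡ : + 2 ℤ.* + (S₁ + h + x) ≡ u ℤ.+ + 2 ℤ.* + x
    lhs≡ = lem s₁ (+ h) (+ x)
      where
      lem : ∀ s h x → + 2 ℤ.* (s ℤ.+ h ℤ.+ x) ≡ (+ 2 ℤ.* s ℤ.+ + 2 ℤ.* h) ℤ.+ + 2 ℤ.* x
      lem = ℤ-Solver.solve-∀
    rhs≡ : + 2 ℤ.* s₁ ℤ.+ value 1 (n + c) (zeros 1 (n + c) % 2) r ≡ u ℤ.+ (C-term β ℤ.+ v)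
    rhs≡ = trans (cong (λ y → + 2 ℤ.* s₁ ℤ.+ y) (trans (value-+ n c r β-eq)
        (cong (λ y → y ℤ.+ v) (trans (cong +_ h-eq) (cong (λ y → y ℤ.+ C-term β) (ℤ.pos-* 2 h))))))
      (lem (+ 2 ℤ.* s₁) (+ 2 ℤ.* + h) (C-term β) v)
      where
      lem : ∀ s h c v → s ℤ.+ (h ℤ.+ c ℤ.+ v) ≡ (s ℤ.+ h) ℤ.+ (c ℤ.+ v)
      lem = ℤ-Solver.solve-∀

  -- The search is finite. Decidability turns the absence of gaps, which only denies a miss, into a
  -- hit.
  hit? : ∀ β i x → Dec (Hit β i x)
  hit? β i x = map′ to from
    (anyUpTo? (λ r → anyUpTo? (λ s → (i ≤? s) ×-dec (+ 2 ℤ.* + x ℤ.≟ sig β i s r)) (suc (i + l ∸ 1))) 3)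
    where
    Bounded : Set
    Bounded = ∃ λ r → r < 3 × ∃ λ s → s < suc (i + l ∸ 1) × i ≤ s × + 2 ℤ.* + x ≡ sig β i s r
    to : Bounded → Hit β i x
    to (r , r<3 , s , s≤s s≤ , i≤s , eq) = r , s , r<3 , i≤s , s≤ , eq
    from : Hit β i x → Bounded
    from (r , s , r<3 , i≤s , s≤ , eq) = r , r<3 , s , s≤s s≤ , i≤s , eq

  mm≤weight : ∀ p → mm ≤ weight p
  mm≤weight p with fib p ≡ᵇ 0
  ... | true = ≤-trans (m⊓n≤n (2 * S₁) ∣ C ∣) (≤-reflexive (cong ∣_∣ C≡))
  ... | false = m⊓n≤m (2 * S₁) ∣ C ∣

  2≤weight : ∀ p → 2 ≤ weight p
  2≤weight p with fib p ≡ᵇ 0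
  ... | true = +-mono-≤ 1≤S₀ 1≤S₂
  ... | false = *-monoʳ-≤ 2 1≤S₁

  2≤mm : 2 ≤ mm
  2≤mm = ⊓-glb (*-monoʳ-≤ 2 1≤S₁) (≤-trans (+-mono-≤ 1≤S₀ 1≤S₂) (≤-reflexive (cong ∣_∣ (sym C≡))))

  ceilDiv-* : ∀ a b → 0 < b → a ≤ ceilDiv a b * b
  ceilDiv-* a (suc b) _ = +-cancelʳ-≤ b _ _ (begin
    a + b                                              ≡⟨ m≡m%n+[m/n]*n (a + b) (suc b) ⟩
    (a + b) % suc b + (a + b) / suc b * suc b          ≤⟨ +-monoˡ-≤ _ (≤-pred (m%n<n (a + b) (suc b))) ⟩
    b + (a + b) / suc b * suc b                        ≡⟨ +-comm b _ ⟩
    (a + b) / suc b * suc b + b                        ∎)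
    where open ≤-Reasoning

  -- The reason for the choice of `l`: every letter weighs at least `mm`, so `l` letters cover both
  -- margins.
  window-weight : ∀ i → 2 * (kk + 2) ≤ Σ[ weight ] i l
  window-weight i = ≤-trans (ceilDiv-* (2 * (kk + 2)) mm (≤-trans z<s 2≤mm)) (Σ-lower weight mm≤weight i l)

  -- A finite complement excludes gaps

  module _ {N} (rep : ∀ n → N ≤ n → InSL S₀ S₁ S₂ n) where

    -- At a return beyond `N`, the translate `S₁ + h + x` of a gap `x` is represented by some `s`.
    -- The margins force `s` into the copy of the window, where the representation becomes a hit.
    no-gap : ∀ β i → 1 ≤ i → ∀ x → ¬ Gap β i x
    no-gap β (suc n) _ x (lo , hi , miss) with %2-bit (zeros 1 n)
    -- The parity `β xor b` through `M`, followed by `n` letters of parity `b`, puts parity `β`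
    -- before the copy of the window. The letter at `M` is an arbitrary choice.
    ... | b , b-eq with return (N + n + suc l) true (β xor b)
    ...   | record { M = M ; large = large ; agree = agree ; even-odd = even-odd } = final
      where
      B W : ℕ
      B = bit β * (S₀ + S₂)
      W = Σ[ weight ] (suc n) (suc l)
      lo′ : B + (kk + 2) ≤ 2 * x
      lo′ = Equivalence.to (low-⇔ β x) lo
      hi′ : 2 * x + (kk + 2) ≤ B + W
      hi′ = Equivalence.to (high-⇔ β n x) hi
      agree-window : ∀ o → o < suc l → fib (suc (M + n) + o) ≡ fib (suc n + o)
      agree-window o o≤l = trans (cong fib (lem M n o)) (agree (suc n + o) z<s
        (≤-trans (≤-trans (≤-reflexive (sym (+-suc n o))) (+-monoʳ-≤ n o≤l)) (≤-trans (m≤n+m (n + suc l) N) (≤-reflexive (sym (+-assoc N n (suc l)))))))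
        where
        lem : ∀ M n o → suc (M + n) + o ≡ M + (suc n + o)
        lem = solve-∀
      zeros-window : ∀ c → c ≤ suc l → zeros (suc (M + n)) c ≡ zeros (suc n) c
      zeros-window c c≤ = Σ-cong c λ o o<c → cong (λ z → if z ≡ᵇ 0 then 1 else 0) (agree-window o (≤-trans o<c c≤))
      weight-window : ∀ c → c ≤ suc l → Σ[ weight ] (suc (M + n)) c ≡ Σ[ weight ] (suc n) c
      weight-window c c≤ = Σ-cong c λ o o<c → cong (λ z → if z ≡ᵇ 0 then S₀ + S₂ else 2 * S₁) (agree-window o (≤-trans o<c c≤))
      parity≡ : zeros 1 (M + n) % 2 ≡ bit β
      parity≡ = trans (cong (_% 2) (trans (Σ-1-+ isZero M n) (cong (λ z → zeros 1 M + z)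
          (Σ-cong {isZero} {isZero} n λ o o<n → cong (λ z → if z ≡ᵇ 0 then 1 else 0)
            (trans (cong fib (sym (+-suc M o))) (agree (suc o) z<s (≤-trans o<n (≤-trans (m≤n+m n N) (m≤m+n _ (suc l))))))))))
        (trans (%2-+ {zeros 1 M} {zeros 1 n} {β xor b} {b} even-odd b-eq) (cong bit (cancel β b)))
        where
        cancel : ∀ β b → (β xor b) xor b ≡ β
        cancel false false = refl
        cancel false true = refl
        cancel true false = refl
        cancel true true = refl
      final : ⊥
      final with half (M + n) parity≡
      ... | h , h-eq with InSL⇒represents {S₁ + h + x} (≤-trans 1≤S₁ (≤-trans (m≤m+n S₁ h) (m≤m+n _ x))) (rep (S₁ + h + x) N≤)
        where
        -- The leftover `B`, which is not in `h`, is covered by `x` because of `lo′`.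
        N≤ : N ≤ S₁ + h + x
        N≤ = *-cancelˡ-≤ 2 (begin
          2 * N                        ≤⟨ *-monoʳ-≤ 2 (≤-trans (≤-trans (≤-trans (m≤m+n N n) (m≤m+n _ (suc l))) (<⇒≤ large)) (m≤m+n M n)) ⟩
          2 * (M + n)                  ≡⟨ *-comm 2 (M + n) ⟩
          (M + n) * 2                  ≤⟨ Σ-lower weight 2≤weight 1 (M + n) ⟩
          Σ[ weight ] 1 (M + n)        ≡⟨ h-eq ⟩
          2 * h + B                    ≤⟨ +-monoʳ-≤ (2 * h) (≤-trans (m≤m+n B (kk + 2)) lo′) ⟩
          2 * h + 2 * x                ≡⟨ *-distribˡ-+ 2 h x ⟨
          2 * (h + x)                  ≤⟨ *-monoʳ-≤ 2 (+-monoˡ-≤ x (m≤n+m h S₁)) ⟩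
          2 * (S₁ + h + x)             ∎)
          where open ≤-Reasoning
      ...   | s , r , r<3 , eq with s ≤? M + n
      -- A sum that ends before the copy is too small, by the lower margin.
      ...     | yes s≤ = <⇒≱ (m<m+n (2 * h + 2 * S₁ + B + kk) (z<s {1})) (begin
        2 * h + 2 * S₁ + B + kk + 2             ≡⟨ lem (2 * h) (2 * S₁) B kk ⟩
        2 * h + 2 * S₁ + (B + (kk + 2))         ≤⟨ +-monoʳ-≤ (2 * h + 2 * S₁) lo′ ⟩
        2 * h + 2 * S₁ + 2 * x                  ≡⟨ lem′ h S₁ x ⟩
        2 * (S₁ + h + x)                        ≤⟨ proj₁ (represents-bounds {S₁ + h + x} {s} {r} eq) ⟩
        2 * S₁ + Σ[ weight ] 1 s + kk           ≤⟨ +-monoˡ-≤ kk (+-monoʳ-≤ (2 * S₁) (Σ-mono weight 1 s≤)) ⟩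
        2 * S₁ + Σ[ weight ] 1 (M + n) + kk     ≡⟨ cong (λ y → 2 * S₁ + y + kk) h-eq ⟩
        2 * S₁ + (2 * h + B) + kk               ≡⟨ lem″ (2 * h) (2 * S₁) B kk ⟩
        2 * h + 2 * S₁ + B + kk                 ∎)
        where
        open ≤-Reasoning
        lem : ∀ h s b k → h + s + b + k + 2 ≡ h + s + (b + (k + 2))
        lem = solve-∀
        lem′ : ∀ h s x → 2 * h + 2 * s + 2 * x ≡ 2 * (s + h + x)
        lem′ = solve-∀
        lem″ : ∀ h s b k → s + (h + b) + k ≡ h + s + b + k
        lem″ = solve-∀
      ...     | no s≰ with M + n + suc l ≤? s
      -- A sum over all `l + 1` letters of the copy is too large, by the upper margin.
      ...       | yes ≤s = <⇒≱ (m<m+n (2 * (S₁ + h + x) + kk) (z<s {1})) (begin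
        2 * (S₁ + h + x) + kk + 2               ≡⟨ lem h S₁ x kk ⟩
        2 * S₁ + 2 * h + (2 * x + (kk + 2))     ≤⟨ +-monoʳ-≤ (2 * S₁ + 2 * h) hi′ ⟩
        2 * S₁ + 2 * h + (B + W)                ≡⟨ lem′ (2 * S₁) (2 * h) B W ⟩
        2 * S₁ + (2 * h + B + W)                ≡⟨ cong (λ y → 2 * S₁ + y) (cong₂ _+_ (sym h-eq) (sym (weight-window (suc l) ≤-refl))) ⟩
        2 * S₁ + (Σ[ weight ] 1 (M + n) + Σ[ weight ] (suc (M + n)) (suc l)) ≡⟨ cong (λ y → 2 * S₁ + y) (Σ-1-+ weight (M + n) (suc l)) ⟨
        2 * S₁ + Σ[ weight ] 1 (M + n + suc l)  ≤⟨ +-monoʳ-≤ (2 * S₁) (Σ-mono weight 1 ≤s) ⟩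
        2 * S₁ + Σ[ weight ] 1 s                ≤⟨ proj₂ (represents-bounds {S₁ + h + x} {s} {r} eq) ⟩
        2 * (S₁ + h + x) + kk                   ∎)
        where
        open ≤-Reasoning
        lem : ∀ h s x k → 2 * (s + h + x) + k + 2 ≡ 2 * s + 2 * h + (2 * x + (k + 2))
        lem = solve-∀
        lem′ : ∀ s h b w → s + h + (b + w) ≡ s + (h + b + w)
        lem′ = solve-∀
      ...       | no ≰s with m≤n⇒∃[o]m+o≡n (≰⇒> s≰)
      -- Here the sum ends after `suc c ≤ l` letters of the copy.
      ...         | c , refl = miss (r , n + suc c , r<3 , m≤m+n-suc , s≤ , (begin
        + 2 ℤ.* + x                                                                 ≡⟨ Equivalence.to (represents-⇔ (M + n) (suc c) r h x parity≡ h-eq) (subst (λ s → Represents (S₁ + h + x) s r) (sym (+-suc (M + n) c)) eq) ⟩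
        C-term β ℤ.+ value (suc (M + n)) (suc c) ((bit β + zeros (suc (M + n)) (suc c)) % 2) r ≡⟨ cong₂ (λ w z → C-term β ℤ.+ (+ w ℤ.+ E r ℤ.+ (O r ℤ.- E r) ℤ.* + ((bit β + z) % 2))) (weight-window (suc c) 1+c≤) (zeros-window (suc c) 1+c≤) ⟩
        C-term β ℤ.+ value (suc n) (suc c) ((bit β + zeros (suc n) (suc c)) % 2) r  ≡⟨ sig≡ β n (suc c) r ⟨
        sig β (suc n) (n + suc c) r                                                 ∎))
        where
        open ≡-Reasoning
        m≤m+n-suc : suc n ≤ n + suc c
        m≤m+n-suc = ≤-trans (m≤m+n (suc n) c) (≤-reflexive (sym (+-suc n c)))
        1+c≤l : suc c ≤ l
        1+c≤l = +-cancelˡ-≤ (M + n) _ _ (≤-trans (≤-reflexive (+-suc (M + n) c)) (≤-pred (≤-trans (≰⇒> ≰s) (≤-reflexive (+-suc (M + n) l)))))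
        1+c≤ : suc c ≤ suc l
        1+c≤ = m≤n⇒m≤1+n 1+c≤l
        s≤ : n + suc c ≤ n + l
        s≤ = +-monoʳ-≤ n 1+c≤l

  -- Absence of gaps makes the complement finite

  module _ (full : ∀ β i → 1 ≤ i → ∀ x → ¬ Gap β i x) where

    private
      Wgt : ℕ → ℕ
      Wgt = Σ[ weight ] 1

    -- Consecutive windows overlap.
    find-window : ∀ {y} → kk + 2 ≤ y → ∀ n → y + (kk + 2) ≤ Wgt (n + suc l) →
      ∃ λ n → Wgt n + (kk + 2) ≤ y × y + (kk + 2) ≤ Wgt (n + suc l)
    find-window lo zero hi = 0 , lo , hi
    find-window {y} lo (suc n) hi with y + (kk + 2) ≤? Wgt (n + suc l)
    ... | yes hi′ = find-window lo n hi′
    ... | no ¬hi = suc n , +-cancelʳ-≤ (kk + 2) _ _ (begin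
      Wgt (suc n) + (kk + 2) + (kk + 2)          ≡⟨ lem (Wgt (suc n)) (kk + 2) ⟩
      Wgt (suc n) + 2 * (kk + 2)                 ≤⟨ +-monoʳ-≤ (Wgt (suc n)) (window-weight (2 + n)) ⟩
      Wgt (suc n) + Σ[ weight ] (2 + n) l        ≡⟨ Σ-1-+ weight (suc n) l ⟨
      Wgt (suc n + l)                            ≡⟨ cong Wgt (+-suc n l) ⟨
      Wgt (n + suc l)                            ≤⟨ <⇒≤ (≰⇒> ¬hi) ⟩
      y + (kk + 2)                               ∎) , hi
      where
      open ≤-Reasoning
      lem : ∀ w k → w + k + k ≡ w + 2 * k
      lem = solve-∀

    -- Write `n = S₁ + y` and take a window whose interval, placed in the word, contains `2 * y`.
    -- Subtracting the half sum `h` before it leaves an integer `x` in the interval of the window;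
    -- `x` is no gap, so it is hit, and the hit translates back.
    all-represented : ∀ n → S₁ + (kk + 2) ≤ n → InSL S₀ S₁ S₂ n
    all-represented n N≤n with m≤n⇒∃[o]m+o≡n (≤-trans (m≤m+n S₁ (kk + 2)) N≤n)
    -- Each letter weighs at least 2, so the first `y + (kk + 2)` letters already exceed `2 * y` by
    -- the margin; the search descends from there.
    ... | y , refl with find-window {2 * y} lo (y + (kk + 2)) hi
      where
      open ≤-Reasoning
      lo : kk + 2 ≤ 2 * y
      lo = ≤-trans (+-cancelˡ-≤ S₁ _ _ N≤n) (m≤m+n y _)
      lem : ∀ y k → 2 * y + 2 * k ≡ (y + k) * 2
      lem = solve-∀
      hi : 2 * y + (kk + 2) ≤ Wgt (y + (kk + 2) + suc l)
      hi = begin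
        2 * y + (kk + 2)               ≤⟨ +-monoʳ-≤ (2 * y) (m≤m+n (kk + 2) _) ⟩
        2 * y + 2 * (kk + 2)           ≡⟨ lem y (kk + 2) ⟩
        (y + (kk + 2)) * 2             ≤⟨ Σ-lower weight 2≤weight 1 (y + (kk + 2)) ⟩
        Wgt (y + (kk + 2))             ≤⟨ Σ-mono weight 1 (m≤m+n (y + (kk + 2)) (suc l)) ⟩
        Wgt (y + (kk + 2) + suc l)     ∎
    ...   | m , lo , hi with %2-bit (zeros 1 m)
    ...     | β , β-eq with half m β-eq
    ...       | h , h-eq with m≤n⇒∃[o]m+o≡n h≤y
      where
      h≤y : h ≤ y
      h≤y = *-cancelˡ-≤ 2 (≤-trans (m≤m+n (2 * h) (bit β * (S₀ + S₂)))
        (≤-trans (≤-reflexive (sym h-eq)) (≤-trans (m≤m+n _ (kk + 2)) lo)))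
    ...         | x , refl = hit⇒InSL (decidable-stable (hit? β (suc m) x) λ miss → full β (suc m) z<s x
        (Equivalence.from (low-⇔ β x) lo′ , Equivalence.from (high-⇔ β m x) hi′ , miss))
      where
      open ≤-Reasoning
      B W : ℕ
      B = bit β * (S₀ + S₂)
      W = Σ[ weight ] (suc m) (suc l)
      lo′ : B + (kk + 2) ≤ 2 * x
      lo′ = +-cancelˡ-≤ (2 * h) _ _ (begin
        2 * h + (B + (kk + 2))  ≡⟨ +-assoc (2 * h) B (kk + 2) ⟨
        2 * h + B + (kk + 2)    ≡⟨ cong (λ w → w + (kk + 2)) h-eq ⟨
        Wgt m + (kk + 2)        ≤⟨ lo ⟩
        2 * (h + x)             ≡⟨ *-distribˡ-+ 2 h x ⟩
        2 * h + 2 * x           ∎)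
      hi′ : 2 * x + (kk + 2) ≤ B + W
      hi′ = +-cancelˡ-≤ (2 * h) _ _ (begin
        2 * h + (2 * x + (kk + 2))  ≡⟨ lem h x (kk + 2) ⟩
        2 * (h + x) + (kk + 2)      ≤⟨ hi ⟩
        Wgt (m + suc l)             ≡⟨ Σ-1-+ weight m (suc l) ⟩
        Wgt m + W                   ≡⟨ cong (λ w → w + W) h-eq ⟩
        2 * h + B + W               ≡⟨ +-assoc (2 * h) B W ⟩
        2 * h + (B + W)             ∎)
        where
        lem : ∀ h x k → 2 * h + (2 * x + k) ≡ 2 * (h + x) + k
        lem = solve-∀
      hit⇒InSL : Hit β (suc m) x → InSL S₀ S₁ S₂ (S₁ + (h + x))
      hit⇒InSL (r , s , r<3 , m<s , s≤ , eq) with m≤n⇒∃[o]m+o≡n (<⇒≤ m<s)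
      ... | c , refl = represents⇒InSL {S₁ + (h + x)} {m + c} r<3 (subst (λ n → Represents n (m + c) r) (+-assoc S₁ h x)
        (Equivalence.from (represents-⇔ m c r h x β-eq h-eq) (trans eq (sig≡ β m c r))))

theorem22 : (S₀ S₁ S₂ : ℕ) → 1 ≤ S₀ → 1 ≤ S₁ → 1 ≤ S₂ → gcd (gcd S₀ S₁) S₂ ≡ 1 →
    let open Doubled S₀ S₁ S₂ in
    (Σ ℕ (λ N → (n : ℕ) → N ≤ n → InSL S₀ S₁ S₂ n))
    ⇔
    ((i : ℕ) → 1 ≤ i →
    ((x : ℕ) →
    ¬ ((+ (kk + 2) ℤ.≤ + 2 ℤ.* (+ x)) ×
    (+ 2 ℤ.* (+ x) ℤ.≤ sumF i (i + l) ℤ.- + (kk + 2)) ×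
    ¬ (Σ ℕ (λ r → Σ ℕ (λ s → r < 3 × i ≤ s × s ≤ i + l ∸ 1 × + 2 ℤ.* (+ x) ≡ sig0 i s r))))) ×
    ((x : ℕ) →
    ¬ ((C ℤ.+ + (kk + 2) ℤ.≤ + 2 ℤ.* (+ x)) ×
    (+ 2 ℤ.* (+ x) ℤ.≤ C ℤ.+ (sumF i (i + l) ℤ.- + (kk + 2))) ×
    ¬ (Σ ℕ (λ r → Σ ℕ (λ s → r < 3 × i ≤ s × s ≤ i + l ∸ 1 × + 2 ℤ.* (+ x) ≡ C ℤ.+ sig1 i s r))))))
theorem22 S₀ S₁ S₂ 1≤S₀ 1≤S₁ 1≤S₂ _ = mk⇔
  (λ (N , rep) i 1≤i → no-gap rep false i 1≤i , no-gap rep true i 1≤i)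
  (λ full → S₁ + (Doubled.kk S₀ S₁ S₂ + 2) , all-represented λ where
    false i 1≤i → proj₁ (full i 1≤i)
    true i 1≤i → proj₂ (full i 1≤i))
  where open Proof S₀ S₁ S₂ 1≤S₀ 1≤S₁ 1≤S₂
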